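{- Let $G=\mathrm{GL}_2(\mathbb Z)$ and let \[ \mathcal M=\{(X,Y,Z)\in G^3:\ X^2+Y^2=Z^2,\ \operatorname{tr}(X)\ge 0,\ \operatorname{tr}(Y)\ge 0,\ \operatorname{tr}(Z)\ge 0\}. \] Let \[ R=\begin{pmatrix}0&-1\\1&-1\end{pmatrix},\quad U=\begin{pmatrix}-1&1\\-1&2\end{pmatrix},\quad V=\begin{pmatrix}2&-1\\3&-1\end{pmatrix},\quad W=\begin{pmatrix}1&0\\1&1\end{pmatrix}, \] and let \[ \mathcal T=\left\{\begin{pmatrix} a & -a-c \\ {a+b} & -a \end{pmatrix}:\ (a,b,c)\in\mathbb Z^3,\ ab+bc+ca=1,\ a\le b,\ a<c\right\}. \] Then \[ \mathcal M=\bigsqcup_{T\in\mathcal T}\mathcal O_G(-R^2,-R,T)\ \sqcup\ \mathcal O_G(U,V,W)\ \sqcup\ \mathcal O_G(V,U,W), \] where $\sqcup$ denotes disjoint union: all the orbits listed on the right-hand side (indexed by the distinct matrices $T\in\mathcal T$, together with the last two) are pairwise disjoint, and their union is $\mathcal M$.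
   Context: For a triple $(X,Y,Z)\in\mathcal M$, its orbit under simultaneous integral conjugation is \[ \mathcal O_G(X,Y,Z)=\{(PXP^{ -1},PYP^{ -1},PZP^{ -1}):P\in G\}. \] -}

module Defs where

open import Algebra.Definitions using (Invertible)
open import Data.Integer using (ℤ; +_; 0ℤ; 1ℤ; -1ℤ; -_; _+_; _-_; _*_; _≤_; _<_)
open import Data.Product using (_×_; _,_; ∃; ∃₂; proj₁)
open import Level using (0ℓ)
open import Relation.Binary.PropositionalEquality using (_≡_)
open import Relation.Unary using (Pred; _∈_)

infixl 7 _·_
infixl 6 _+ₘ_
infix  8 -ₘ_

-- mat a b c d is the matrix with rows (a , b) and (c , d).
record Mat : Set where
  constructor mat
  field
    e₁₁ e₁₂ e₂₁ e₂₂ : ℤ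

_·_ : Mat → Mat → Mat
mat a b c d · mat a′ b′ c′ d′ =
  mat (a * a′ + b * c′) (a * b′ + b * d′)
      (c * a′ + d * c′) (c * b′ + d * d′)

_+ₘ_ : Mat → Mat → Mat
mat a b c d +ₘ mat a′ b′ c′ d′ = mat (a + a′) (b + b′) (c + c′) (d + d′)

-ₘ_ : Mat → Mat
-ₘ mat a b c d = mat (- a) (- b) (- c) (- d)

1ₘ : Mat
1ₘ = mat 1ℤ 0ℤ
         0ℤ 1ℤ

tr : Mat → ℤ
tr (mat a _ _ d) = a + d

-- GL₂(ℤ), as the set of invertible elements of the monoid of 2 × 2 integer
-- matrices.
G : Pred Mat 0ℓ
G = Invertible _≡_ 1ₘ _·_

-- conj P∈G X is P X P⁻¹; the inverse is the one carried by P∈G (it is unique).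
conj : ∀ {P} → P ∈ G → Mat → Mat
conj {P} P∈G X = P · X · proj₁ P∈G

Triple : Set
Triple = Mat × Mat × Mat

ℳ : Pred Triple 0ℓ
ℳ (X , Y , Z) =
  (X ∈ G × Y ∈ G × Z ∈ G) ×
  X · X +ₘ Y · Y ≡ Z · Z ×
  0ℤ ≤ tr X × 0ℤ ≤ tr Y × 0ℤ ≤ tr Z

𝒪 : Triple → Pred Triple 0ℓ
𝒪 (X , Y , Z) t = ∃₂ λ P (P∈G : P ∈ G) →
  t ≡ (conj P∈G X , conj P∈G Y , conj P∈G Z)

R U V W : Mat
R = mat 0ℤ -1ℤ
        1ℤ -1ℤ
U = mat -1ℤ 1ℤ
        -1ℤ (+ 2)
V = mat (+ 2) -1ℤ
        (+ 3) -1ℤ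
W = mat 1ℤ 0ℤ
        1ℤ 1ℤ

𝒯 : Pred Mat 0ℓ
𝒯 T = ∃ λ a → ∃ λ b → ∃ λ c →
  a * b + b * c + c * a ≡ 1ℤ × a ≤ b × a < c ×
  T ≡ mat a       (- a - c)
          (a + b) (- a)

{-# OPTIONS --safe #-}
module Submission where

-- Write x, y, z for the traces and δ, ε, ζ for the determinants of X, Y, Z.  By
-- Cayley–Hamilton and det (A + B) = det A + det B + tr (A adj B), comparing traces
-- and determinants in X² + Y² = Z², in Z² − X² = Y² and in Z² − Y² = X² gives
--   x² + y² − z² = 2 (δ + ε − ζ)       xy ∣ εx² + δy² − 2δε − 1
--   xz ∣ ζx² + δz² − 2δζ + 1           yz ∣ ζy² + εz² − 2εζ + 1.
-- A size argument bounds the solutions, and a finite search leaves x = y = 1 with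
-- z = 0 and δ = ε = ζ = 1, or z = 2 and (δ, ε, ζ) one of (−1, 1, 1), (1, −1, 1),
-- (−1, −1, −1).
-- A matrix of trace and determinant 1 is conjugate to −R², by reduction of a form
-- of discriminant −3.  Moving X there in the first case forces Y = −R and leaves Z
-- free; conjugation by R permutes (a, b, c) cyclically, which makes a minimal, and
-- T is unique because the centraliser of R is generated by −1 and R.  Moving Y
-- there in the second case leaves three pairs (X, Z), the integer points of an
-- ellipse; the third case is its mirror image.  In the last case −X² adj (Y²) has
-- trace and determinant 1, and moving it to −R² gives a contradiction modulo 3.

open import Algebra.Bundles using (AbelianGroup)
open import Data.Empty using (⊥-elim)
open import Data.Fin.Base using (Fin; toℕ)
open import Data.Fin.Properties using (all?; toℕ≤pred[n]; toℕ-fromℕ<)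
open import Data.Integer using (ℤ; +_; +[1+_]; -[1+_]; 0ℤ; 1ℤ; -1ℤ; -_; _+_; _-_; _*_; _≤_; _<_; +≤+; ∣_∣; NonZero)
open import Data.Integer.DivMod using (_/_; _%_; a≡a%n+[a/n]*n; n%d<d)
open import Data.Integer.Divisibility.Signed using (_∣_; divides; _∣?_)
open import Data.Integer.Properties
open import Algebra.Properties.Group (AbelianGroup.group +-0-abelianGroup) using (∙-cancelʳ)
open import Data.Integer.Tactic.RingSolver using (solve; solve-∀)
open import Data.List.Base using (_∷_; [])
open import Data.Nat.Base as ℕ using (ℕ; suc; z≤n; s≤s)
import Data.Nat.Properties as ℕ
open import Data.Product using (_×_; _,_; ∃; ∃₂; proj₁; proj₂)
open import Data.Sum using (_⊎_; inj₁; inj₂; [_,_]′)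
open import Defs
open import Function.Base using (id)
open import Relation.Binary.PropositionalEquality
open import Relation.Nullary.Decidable using (Dec; map′; _×-dec_; _⊎-dec_; _→-dec_; from-yes; ¬?; yes; no)
open import Relation.Nullary.Negation using (¬_; contradiction)
open import Relation.Unary using (_∈_; _∪_; _≐_; _⊥_)

open Mat

-- Linear combinations of equations and certificates of nonnegativity

-- In k ⊛ e ⊕ k′ ⊛ e′ ⊢ h, the goal p ≡ q follows from a linear combination l ≡ r
-- of the equations e, e′, because p + r ≡ q + l is a ring identity.
infixl 6 _⊕_
infixl 7 _⊛_
infix  5 _⊢_

_⊕_ : ∀ {a b c d : ℤ} → a ≡ b → c ≡ d → a + c ≡ b + d
_⊕_ = cong₂ _+_

_⊛_ : ∀ {a b : ℤ} k → a ≡ b → k * a ≡ k * b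
k ⊛ e = cong (k *_) e

_⊢_ : ∀ {l r p q : ℤ} → l ≡ r → p + r ≡ q + l → p ≡ q
_⊢_ {l} {r} {p} {q} refl e = ∙-cancelʳ l p q e

infixl 6 _∔_
infixl 7 _∙_

_∔_ : ∀ {a b} → 0ℤ ≤ a → 0ℤ ≤ b → 0ℤ ≤ a + b
_∔_ = +-mono-≤

_∙_ : ∀ {a b} → 0ℤ ≤ a → 0ℤ ≤ b → 0ℤ ≤ a * b
_∙_ {+ m} {+ n} _ _ = subst (0ℤ ≤_) (pos-* m n) (+≤+ z≤n)

0≤+ : ∀ n → 0ℤ ≤ + n
0≤+ _ = +≤+ z≤n

infix 4 _by_
_by_ : ∀ {a b} → 0ℤ ≤ a → a ≡ b → 0ℤ ≤ b
0≤a by refl = 0≤a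

-- Closes a contradictory set of bounds: a combination of nonnegative products, built with `_∔_` and
-- `_∙_`, collapses modulo the equations to -(n + 1).
refute : ∀ {A : Set} {a} n → 0ℤ ≤ a → a ≡ -[1+ n ] → A
refute n () refl

-- Discreteness of ℤ: a negative i has 0 ≤ -1 - i.
split : ∀ i → 0ℤ ≤ i ⊎ 0ℤ ≤ -1ℤ - i
split (+ n) = inj₁ (0≤+ n)
split -[1+ n ] = inj₂ (subst (0ℤ ≤_) (flip (+ n)) (0≤+ n))
  where
  flip : ∀ i → i ≡ -1ℤ - - (1ℤ + i)
  flip = solve-∀

by-cases : ∀ {A : Set} i → (0ℤ ≤ i → A) → (0ℤ ≤ -1ℤ - i → A) → A
by-cases i f g = [ f , g ]′ (split i)

by-contra : ∀ {i} → (0ℤ ≤ -1ℤ - i → 0ℤ ≤ i) → 0ℤ ≤ i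
by-contra {i} f = by-cases i id f

Sign : ℤ → Set
Sign i = i ≡ 1ℤ ⊎ i ≡ -1ℤ

sign² : ∀ {i} → Sign i → i * i ≡ 1ℤ
sign² (inj₁ refl) = refl
sign² (inj₂ refl) = refl

-1≤sign : ∀ {i} → Sign i → 0ℤ ≤ 1ℤ + i
-1≤sign (inj₁ refl) = 0≤+ 2
-1≤sign (inj₂ refl) = 0≤+ 0

sign≤1 : ∀ {i} → Sign i → 0ℤ ≤ 1ℤ - i
sign≤1 (inj₁ refl) = 0≤+ 0
sign≤1 (inj₂ refl) = 0≤+ 2

∀Sign? : {P : ℤ → Set} → (∀ i → Dec (P i)) → Dec (∀ i → Sign i → P i)
∀Sign? P? = map′
  (λ { (p , _) _ (inj₁ refl) → p ; (_ , p) _ (inj₂ refl) → p })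
  (λ p → p 1ℤ (inj₁ refl) , p -1ℤ (inj₂ refl))
  (P? 1ℤ ×-dec P? -1ℤ)

∀≤? : ∀ n {P : ℤ → Set} → (∀ i → Dec (P i)) → Dec (∀ i → 0ℤ ≤ i → 0ℤ ≤ + n - i → P i)
∀≤? n {P} P? = map′
  (λ { p (+ i) _ i≤n → subst (λ j → P (+ j)) (toℕ-fromℕ< (s≤s (drop‿+≤+ (0≤i-j⇒j≤i i≤n)))) (p _) })
  (λ p i → p (+ toℕ i) (+≤+ z≤n) (i≤j⇒0≤j-i (+≤+ (toℕ≤pred[n] i))))
  (all? (λ (i : Fin (suc n)) → P? (+ toℕ i)))

-- The trace equations

-- The fourth alternative meets every numerical condition but comes from no matrices;
-- `no-all-negative` removes it.
Solution : ℤ → ℤ → ℤ → ℤ → ℤ → ℤ → Set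
Solution δ ε ζ x y z = x ≡ 1ℤ × y ≡ 1ℤ ×
  ( (δ ≡ 1ℤ × ε ≡ 1ℤ × ζ ≡ 1ℤ × z ≡ 0ℤ)
  ⊎ (δ ≡ -1ℤ × ε ≡ 1ℤ × ζ ≡ 1ℤ × z ≡ + 2)
  ⊎ (δ ≡ 1ℤ × ε ≡ -1ℤ × ζ ≡ 1ℤ × z ≡ + 2)
  ⊎ (δ ≡ -1ℤ × ε ≡ -1ℤ × ζ ≡ -1ℤ × z ≡ + 2))

solution? : ∀ δ ε ζ x y z → Dec (Solution δ ε ζ x y z)
solution? δ ε ζ x y z = x ≟ 1ℤ ×-dec y ≟ 1ℤ ×-dec
  (     (δ ≟ 1ℤ ×-dec ε ≟ 1ℤ ×-dec ζ ≟ 1ℤ ×-dec z ≟ 0ℤ)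
  ⊎-dec (δ ≟ -1ℤ ×-dec ε ≟ 1ℤ ×-dec ζ ≟ 1ℤ ×-dec z ≟ + 2)
  ⊎-dec (δ ≟ 1ℤ ×-dec ε ≟ -1ℤ ×-dec ζ ≟ 1ℤ ×-dec z ≟ + 2)
  ⊎-dec (δ ≟ -1ℤ ×-dec ε ≟ -1ℤ ×-dec ζ ≟ -1ℤ ×-dec z ≟ + 2))

-- Decided by evaluation on the box supplied by `Bounds`. A zero trace is covered, since 0 ∣ n means
-- n = 0.
small-solutions : ∀ δ → Sign δ → ∀ ε → Sign ε → ∀ ζ → Sign ζ →
  ∀ x → 0ℤ ≤ x → 0ℤ ≤ + 10 - x → ∀ y → 0ℤ ≤ y → 0ℤ ≤ + 10 - y → ∀ z → 0ℤ ≤ z → 0ℤ ≤ + 14 - z →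
  x * x + y * y - z * z ≡ + 2 * (δ + ε - ζ) →
  x * y ∣ ε * (x * x) + δ * (y * y) - + 2 * (δ * ε) - 1ℤ →
  x * z ∣ ζ * (x * x) + δ * (z * z) - + 2 * (δ * ζ) + 1ℤ →
  y * z ∣ ζ * (y * y) + ε * (z * z) - + 2 * (ε * ζ) + 1ℤ →
  Solution δ ε ζ x y z
small-solutions = from-yes
  (∀Sign? λ δ → ∀Sign? λ ε → ∀Sign? λ ζ → ∀≤? 10 λ x → ∀≤? 10 λ y → ∀≤? 14 λ z →
    (x * x + y * y - z * z ≟ + 2 * (δ + ε - ζ)) →-dec
    (x * y ∣? ε * (x * x) + δ * (y * y) - + 2 * (δ * ε) - 1ℤ) →-dec
    (x * z ∣? ζ * (x * x) + δ * (z * z) - + 2 * (δ * ζ) + 1ℤ) →-dec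
    (y * z ∣? ζ * (y * y) + ε * (z * z) - + 2 * (ε * ζ) + 1ℤ) →-dec
    solution? δ ε ζ x y z)

-- A sum of three signs is odd, so its double is 2 modulo 4. The range x ≤ 2 makes this a finite
-- check.
twice-odd-not-square : ∀ δ → Sign δ → ∀ ε → Sign ε → ∀ ζ → Sign ζ →
  ∀ x → 0ℤ ≤ x → 0ℤ ≤ + 2 - x → x * x ≢ + 2 * (δ + ε - ζ)
twice-odd-not-square = from-yes
  (∀Sign? λ δ → ∀Sign? λ ε → ∀Sign? λ ζ → ∀≤? 2 λ x → ¬? (x * x ≟ + 2 * (δ + ε - ζ)))

-- Exchanging X and Y allows x ≤ y. Three cases bound y: x ≥ 3 with ζ = ε, x ≥ 3 with ζ = -ε, and x
-- ≤ 2. The common bound 10 is a round number, not a sharp one.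
module Bounds {δ ε ζ x y z t v : ℤ} (sδ : Sign δ) (sε : Sign ε) (sζ : Sign ζ)
  (0≤x : 0ℤ ≤ x) (x≤y : 0ℤ ≤ y - x) (0≤z : 0ℤ ≤ z)
  (e₀ : x * x + y * y - z * z ≡ + 2 * (δ + ε - ζ))
  (e₁ : x * y * t ≡ ε * (x * x) + δ * (y * y) - + 2 * (δ * ε) - 1ℤ)
  (e₃ : y * z * v ≡ ζ * (y * y) + ε * (z * z) - + 2 * (ε * ζ) + 1ℤ)
  where

  0≤y : 0ℤ ≤ y
  0≤y = x≤y ∔ 0≤x by solve (x ∷ y ∷ [])

  -- x² ≥ 9 exceeds 2 (δ + ε - ζ) ≤ 6, so z² > y².
  y<z : 0ℤ ≤ x - + 3 → 0ℤ ≤ z - y - 1ℤ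
  y<z 3≤x = by-contra λ p → refute 2
    (p ∙ (0≤y ∔ 0≤z) ∔ 3≤x ∙ (3≤x ∔ 0≤+ 6) ∔ 0≤+ 2 ∙ (sign≤1 sδ ∔ sign≤1 sε ∔ -1≤sign sζ))
    (1ℤ ⊛ e₀ ⊢ solve (δ ∷ ε ∷ ζ ∷ x ∷ y ∷ z ∷ []))

  -- yz(εv) = y² + z² − ε with z slightly larger than y forces εv ≤ 2, hence
  -- z = y + 1; the first divisibility then becomes x ∣ 3.
  module _ (eq : ζ ≡ ε) (3≤x : 0ℤ ≤ x - + 3) where
    private
      e₃′ : y * z * (ε * v) ≡ y * y + z * z - ε
      e₃′ = ε ⊛ e₃ ⊕ (ε * (y * y) - + 2 * (ε * ε)) ⊛ eq ⊕ (y * y + z * z - + 2 * ε) ⊛ sign² sε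
        ⊢ solve (ε ∷ ζ ∷ y ∷ z ∷ v ∷ [])

      e₀′ : x * x + y * y - z * z ≡ + 2 * δ
      e₀′ = 1ℤ ⊛ e₀ ⊕ -[1+ 1 ] ⊛ eq ⊢ solve (δ ∷ ε ∷ ζ ∷ x ∷ y ∷ z ∷ [])

      -- If εv ≥ 3, then 3y(y + 1) ≤ 3yz ≤ y² + z² - ε = 2y² + x² - 2δ - ε ≤ 3y² + 3, against y ≥ 3.
      εv≤2 : 0ℤ ≤ + 2 - ε * v
      εv≤2 = by-contra λ p → refute 5
        (p ∙ (0≤y ∙ 0≤z) ∔ 0≤+ 3 ∙ (0≤y ∙ y<z 3≤x) ∔ x≤y ∙ (0≤x ∔ 0≤y) ∔ 0≤+ 3 ∙ x≤y ∔ 0≤+ 3 ∙ 3≤x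
          ∔ 0≤+ 2 ∙ -1≤sign sδ ∔ -1≤sign sε)
        (1ℤ ⊛ e₃′ ⊕ -1ℤ ⊛ e₀′ ⊢ solve (δ ∷ ε ∷ x ∷ y ∷ z ∷ v ∷ []))

      -- Now y² + z² - ε ≤ 2yz, that is (z - y)² ≤ ε. As z > y, this also forces ε = 1.
      z≤y+1 : 0ℤ ≤ y + 1ℤ - z
      z≤y+1 = by-contra λ p → refute 2
        (εv≤2 ∙ (0≤y ∙ 0≤z) ∔ p ∙ (p ∔ 0≤+ 4) ∔ sign≤1 sε)
        (-1ℤ ⊛ e₃′ ⊢ solve (ε ∷ y ∷ z ∷ v ∷ []))

      z≡y+1 : z ≡ y + 1ℤ
      z≡y+1 = ≤-antisym (0≤i-j⇒j≤i z≤y+1) (0≤i-j⇒j≤i (y<z 3≤x by solve (y ∷ z ∷ [])))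

      ε≡1 : ε ≡ 1ℤ
      ε≡1 = ≤-antisym (0≤i-j⇒j≤i (sign≤1 sε)) (0≤i-j⇒j≤i
        (εv≤2 ∙ (0≤y ∙ 0≤z) ∔ y<z 3≤x ∙ (y<z 3≤x ∔ 0≤+ 2)
          by (-1ℤ ⊛ e₃′ ⊢ solve (ε ∷ y ∷ z ∷ v ∷ []))))

      x²≡2y+2δ+1 : x * x ≡ + 2 * y + + 2 * δ + 1ℤ
      x²≡2y+2δ+1 = 1ℤ ⊛ e₀′ ⊕ (z + y + 1ℤ) ⊛ z≡y+1 ⊢ solve (δ ∷ x ∷ y ∷ z ∷ [])

      -- Multiplying `e₁` by 4δ and substituting 2y = x² - 2δ - 1 gives 4δxyt = x⁴ - 2x² - 3.
      xq≡3 : x * (x * x * x - + 2 * x - + 4 * δ * y * t) ≡ + 3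
      xq≡3 = (-[1+ 3 ] * δ) ⊛ e₁ ⊕ (-[1+ 3 ] * δ * (x * x - + 2 * δ)) ⊛ ε≡1
          ⊕ (+ 4 - + 4 * (y * y)) ⊛ sign² sδ ⊕ (x * x - + 2 * δ - 1ℤ + + 2 * y) ⊛ x²≡2y+2δ+1
        ⊢ solve (δ ∷ ε ∷ x ∷ y ∷ t ∷ [])

      x≤3 : 0ℤ ≤ + 3 - x
      x≤3 = by-contra λ p →
        by-cases (x * x * x - + 2 * x - + 4 * δ * y * t - 1ℤ)
          (λ 1≤q → refute 0 (p ∙ (1≤q ∔ 0≤+ 1) ∔ 0≤+ 4 ∙ 1≤q) (1ℤ ⊛ xq≡3 ⊢ solve (δ ∷ x ∷ y ∷ t ∷ [])))
          (λ q≤0 → refute 2 (0≤x ∙ q≤0) (-1ℤ ⊛ xq≡3 ⊢ solve (δ ∷ x ∷ y ∷ t ∷ [])))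

    y≤10-same : 0ℤ ≤ + 10 - y
    y≤10-same = by-contra λ p → refute 11
      (0≤+ 2 ∙ p ∔ x≤3 ∙ (0≤+ 3 ∔ 0≤x) ∔ 0≤+ 2 ∙ -1≤sign sδ)
      (-1ℤ ⊛ x²≡2y+2δ+1 ⊢ solve (δ ∷ x ∷ y ∷ []))

  -- Here yz(εv) lies strictly between 0 and x² + 4, although z > y ≥ x.
  module _ (eq : ζ ≡ - ε) (3≤x : 0ℤ ≤ x - + 3) where
    private
      e₃′ : y * z * (ε * v) ≡ x * x - + 2 * δ - ε
      e₃′ = ε ⊛ e₃ ⊕ -1ℤ ⊛ e₀ ⊕ (ε * (y * y) - + 2 * (ε * ε) + + 2) ⊛ eq
          ⊕ (z * z - y * y + + 2 * ε) ⊛ sign² sε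
        ⊢ solve (δ ∷ ε ∷ ζ ∷ x ∷ y ∷ z ∷ v ∷ [])

    y≤3-opposite : 0ℤ ≤ + 3 - y
    y≤3-opposite = by-contra λ p →
      by-cases (ε * v - 1ℤ)
        (λ 1≤εv → refute 0
          (1≤εv ∙ (0≤y ∙ 0≤z) ∔ 0≤y ∙ y<z 3≤x ∔ x≤y ∙ (0≤x ∔ 0≤y) ∔ p ∔ 0≤+ 2 ∙ -1≤sign sδ ∔ -1≤sign sε)
          (1ℤ ⊛ e₃′ ⊢ solve (δ ∷ ε ∷ x ∷ y ∷ z ∷ v ∷ [])))
        (λ εv≤0 → refute 5
          (εv≤0 ∙ (0≤y ∙ 0≤z) ∔ 3≤x ∙ (3≤x ∔ 0≤+ 6) ∔ 0≤+ 2 ∙ sign≤1 sδ ∔ sign≤1 sε)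
          (-1ℤ ⊛ e₃′ ⊢ solve (δ ∷ ε ∷ x ∷ y ∷ z ∷ v ∷ [])))

  -- Here z² - y² = x² - 2 (δ + ε - ζ) is at most 10 in absolute value, so y > 10 forces z = y, and
  -- x² would be twice an odd number.
  y≤10-small : 0ℤ ≤ + 2 - x → 0ℤ ≤ + 10 - y
  y≤10-small x≤2 = by-contra λ p →
    by-cases (z - y - 1ℤ)
      (λ y<z → refute 12
        (y<z ∙ (0≤z ∔ 0≤y ∔ 0≤+ 1) ∔ x≤2 ∙ (0≤+ 2 ∔ 0≤x) ∔ 0≤+ 2 ∙ p
          ∔ 0≤+ 2 ∙ (-1≤sign sδ ∔ -1≤sign sε ∔ sign≤1 sζ))
        (-1ℤ ⊛ e₀ ⊢ solve (δ ∷ ε ∷ ζ ∷ x ∷ y ∷ z ∷ [])))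
      (λ z≤y → by-cases (y - z - 1ℤ)
        (λ z<y → refute 4
          (z<y ∙ (0≤z ∔ 0≤y) ∔ 0≤z ∔ p ∔ 0≤x ∙ 0≤x
            ∔ 0≤+ 2 ∙ (sign≤1 sδ ∔ sign≤1 sε ∔ -1≤sign sζ))
          (1ℤ ⊛ e₀ ⊢ solve (δ ∷ ε ∷ ζ ∷ x ∷ y ∷ z ∷ [])))
        (λ y≤z → ⊥-elim (twice-odd-not-square δ sδ ε sε ζ sζ x 0≤x x≤2
          (1ℤ ⊛ e₀ ⊕ (y + z) ⊛ ≤-antisym {z} {y}
            (0≤i-j⇒j≤i (z≤y by solve (y ∷ z ∷ [])))
            (0≤i-j⇒j≤i (y≤z by solve (y ∷ z ∷ [])))
          ⊢ solve (δ ∷ ε ∷ ζ ∷ x ∷ y ∷ z ∷ [])))))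

  y≤10 : 0ℤ ≤ + 10 - y
  y≤10 = by-cases (x - + 3) (λ 3≤x → large 3≤x sε sζ) (λ x≤2 → y≤10-small (x≤2 by solve (x ∷ [])))
    where
    large : 0ℤ ≤ x - + 3 → Sign ε → Sign ζ → 0ℤ ≤ + 10 - y
    large 3≤x (inj₁ ε≡1) (inj₁ ζ≡1) = y≤10-same (trans ζ≡1 (sym ε≡1)) 3≤x
    large 3≤x (inj₂ ε≡-1) (inj₂ ζ≡-1) = y≤10-same (trans ζ≡-1 (sym ε≡-1)) 3≤x
    large 3≤x (inj₁ ε≡1) (inj₂ ζ≡-1) =
      y≤3-opposite (trans ζ≡-1 (cong -_ (sym ε≡1))) 3≤x ∔ 0≤+ 7 by solve (y ∷ [])
    large 3≤x (inj₂ ε≡-1) (inj₁ ζ≡1) =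
      y≤3-opposite (trans ζ≡1 (cong -_ (sym ε≡-1))) 3≤x ∔ 0≤+ 7 by solve (y ∷ [])

  z≤14 : 0ℤ ≤ + 14 - z
  z≤14 = by-contra λ p → refute 18
    (p ∙ (0≤z ∔ 0≤+ 15) ∔ y≤10 ∙ (0≤+ 10 ∔ 0≤y) ∔ x≤10 ∙ (0≤+ 10 ∔ 0≤x)
      ∔ 0≤+ 2 ∙ (-1≤sign sδ ∔ -1≤sign sε ∔ sign≤1 sζ))
    (-1ℤ ⊛ e₀ ⊢ solve (δ ∷ ε ∷ ζ ∷ x ∷ y ∷ z ∷ []))
    where
    x≤10 : 0ℤ ≤ + 10 - x
    x≤10 = y≤10 ∔ x≤y by solve (x ∷ y ∷ [])

solution-swap : ∀ {δ ε ζ x y z} → Solution ε δ ζ y x z → Solution δ ε ζ x y z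
solution-swap (y≡1 , x≡1 , inj₁ (ε≡ , δ≡ , rest)) = x≡1 , y≡1 , inj₁ (δ≡ , ε≡ , rest)
solution-swap (y≡1 , x≡1 , inj₂ (inj₁ (ε≡ , δ≡ , rest))) = x≡1 , y≡1 , inj₂ (inj₂ (inj₁ (δ≡ , ε≡ , rest)))
solution-swap (y≡1 , x≡1 , inj₂ (inj₂ (inj₁ (ε≡ , δ≡ , rest)))) = x≡1 , y≡1 , inj₂ (inj₁ (δ≡ , ε≡ , rest))
solution-swap (y≡1 , x≡1 , inj₂ (inj₂ (inj₂ (ε≡ , δ≡ , rest)))) = x≡1 , y≡1 , inj₂ (inj₂ (inj₂ (δ≡ , ε≡ , rest)))

trace-equations : ∀ {δ ε ζ x y z} t u v → Sign δ → Sign ε → Sign ζ → 0ℤ ≤ x → 0ℤ ≤ y → 0ℤ ≤ z →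
  x * x + y * y - z * z ≡ + 2 * (δ + ε - ζ) →
  x * y * t ≡ ε * (x * x) + δ * (y * y) - + 2 * (δ * ε) - 1ℤ →
  x * z * u ≡ ζ * (x * x) + δ * (z * z) - + 2 * (δ * ζ) + 1ℤ →
  y * z * v ≡ ζ * (y * y) + ε * (z * z) - + 2 * (ε * ζ) + 1ℤ →
  Solution δ ε ζ x y z
trace-equations {δ} {ε} {ζ} {x} {y} {z} t u v sδ sε sζ 0≤x 0≤y 0≤z e₀ e₁ e₂ e₃ = by-cases (y - x)
  (λ x≤y → ordered {x = x} {y = y} t u v sδ sε sζ 0≤x x≤y 0≤z e₀ e₁ e₂ e₃)
  (λ y<x → solution-swap (ordered {x = y} {y = x} t v u sε sδ sζ 0≤y (y<x ∔ 0≤+ 1 by solve (x ∷ y ∷ [])) 0≤z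
    (1ℤ ⊛ e₀ ⊢ solve (δ ∷ ε ∷ ζ ∷ x ∷ y ∷ z ∷ []))
    (1ℤ ⊛ e₁ ⊢ solve (δ ∷ ε ∷ x ∷ y ∷ t ∷ [])) e₃ e₂))
  where
  ordered : ∀ {δ ε ζ x y z} t u v → Sign δ → Sign ε → Sign ζ → 0ℤ ≤ x → 0ℤ ≤ y - x → 0ℤ ≤ z →
    x * x + y * y - z * z ≡ + 2 * (δ + ε - ζ) →
    x * y * t ≡ ε * (x * x) + δ * (y * y) - + 2 * (δ * ε) - 1ℤ →
    x * z * u ≡ ζ * (x * x) + δ * (z * z) - + 2 * (δ * ζ) + 1ℤ →
    y * z * v ≡ ζ * (y * y) + ε * (z * z) - + 2 * (ε * ζ) + 1ℤ →
    Solution δ ε ζ x y z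
  ordered {δ} {ε} {ζ} {x} {y} {z} t u v sδ sε sζ 0≤x x≤y 0≤z e₀ e₁ e₂ e₃ =
    small-solutions δ sδ ε sε ζ sζ x 0≤x (B.y≤10 ∔ x≤y by solve (x ∷ y ∷ [])) y B.0≤y B.y≤10 z 0≤z B.z≤14 e₀
      (∣-of e₁) (∣-of e₂) (∣-of e₃)
    where
    module B = Bounds {t = t} {v = v} sδ sε sζ 0≤x x≤y 0≤z e₀ e₁ e₃
    ∣-of : ∀ {k q n} → k * q ≡ n → k ∣ n
    ∣-of {k} {q} eq = divides q (trans (sym eq) (*-comm k q))

-- Traces and determinants of 2 × 2 matrices

det : Mat → ℤ
det (mat a b c d) = a * d - b * c

-- tr (X · adj Y), the polarisation of det.
⟨_,_⟩ : Mat → Mat → ℤ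
⟨ mat a b c d , mat a′ b′ c′ d′ ⟩ = a * d′ - b * c′ - c * b′ + d * a′

adj : Mat → Mat
adj (mat a b c d) = mat d (- b) (- c) a

mat≡ : ∀ {a b c d a′ b′ c′ d′} → a ≡ a′ → b ≡ b′ → c ≡ c′ → d ≡ d′ → mat a b c d ≡ mat a′ b′ c′ d′
mat≡ refl refl refl refl = refl

·-assoc : ∀ X Y Z → X · Y · Z ≡ X · (Y · Z)
·-assoc (mat a b c d) (mat e f g h) (mat i j k l) = mat≡
  (entry a b e f g h i k) (entry a b e f g h j l) (entry c d e f g h i k) (entry c d e f g h j l)
  where
  entry : ∀ a b e f g h i k →
    (a * e + b * g) * i + (a * f + b * h) * k ≡ a * (e * i + f * k) + b * (g * i + h * k)
  entry = solve-∀

·-identityˡ : ∀ X → 1ₘ · X ≡ X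
·-identityˡ (mat a b c d) = mat≡ (top a c) (top b d) (bottom a c) (bottom b d)
  where
  top : ∀ a c → 1ℤ * a + 0ℤ * c ≡ a
  top = solve-∀
  bottom : ∀ a c → 0ℤ * a + 1ℤ * c ≡ c
  bottom = solve-∀

·-identityʳ : ∀ X → X · 1ₘ ≡ X
·-identityʳ (mat a b c d) = mat≡ (left a b) (right a b) (left c d) (right c d)
  where
  left : ∀ a b → a * 1ℤ + b * 0ℤ ≡ a
  left = solve-∀
  right : ∀ a b → a * 0ℤ + b * 1ℤ ≡ b
  right = solve-∀

·-distribˡ : ∀ X Y Z → X · (Y +ₘ Z) ≡ X · Y +ₘ X · Z
·-distribˡ (mat a b c d) (mat e f g h) (mat i j k l) = mat≡
  (entry a b e g i k) (entry a b f h j l) (entry c d e g i k) (entry c d f h j l)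
  where
  entry : ∀ a b e g i k → a * (e + i) + b * (g + k) ≡ a * e + b * g + (a * i + b * k)
  entry = solve-∀

·-distribʳ : ∀ X Y Z → (Y +ₘ Z) · X ≡ Y · X +ₘ Z · X
·-distribʳ (mat a b c d) (mat e f g h) (mat i j k l) = mat≡
  (entry a c e f i j) (entry b d e f i j) (entry a c g h k l) (entry b d g h k l)
  where
  entry : ∀ a c e f i j → (e + i) * a + (f + j) * c ≡ e * a + f * c + (i * a + j * c)
  entry = solve-∀

tr-comm : ∀ X Y → tr (X · Y) ≡ tr (Y · X)
tr-comm (mat a b c d) (mat e f g h) = lemma a b c d e f g h
  where
  lemma : ∀ a b c d e f g h → a * e + b * g + (c * f + d * h) ≡ e * a + f * c + (g * b + h * d)
  lemma = solve-∀

det-· : ∀ X Y → det (X · Y) ≡ det X * det Y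
det-· (mat a b c d) (mat e f g h) = lemma a b c d e f g h
  where
  lemma : ∀ a b c d e f g h →
    (a * e + b * g) * (c * f + d * h) - (a * f + b * h) * (c * e + d * g) ≡
    (a * d - b * c) * (e * h - f * g)
  lemma = solve-∀

tr-² : ∀ X → tr (X · X) ≡ tr X * tr X - + 2 * det X
tr-² (mat a b c d) = lemma a b c d
  where
  lemma : ∀ a b c d → a * a + b * c + (c * b + d * d) ≡ (a + d) * (a + d) - + 2 * (a * d - b * c)
  lemma = solve-∀

det-+ : ∀ X Y → det (X +ₘ Y) ≡ det X + det Y + ⟨ X , Y ⟩
det-+ (mat a b c d) (mat e f g h) = lemma a b c d e f g h
  where
  lemma : ∀ a b c d e f g h → (a + e) * (d + h) - (b + f) * (c + g) ≡
    a * d - b * c + (e * h - f * g) + (a * h - b * g - c * f + d * e)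
  lemma = solve-∀

-- This is det (Z - X) = det X + det Z - ⟨X, Z⟩ at Z = X + Y, phrased without subtracting matrices.
det-summand : ∀ X Y → det Y ≡ det X + det (X +ₘ Y) - ⟨ X , X +ₘ Y ⟩
det-summand (mat a b c d) (mat e f g h) = lemma a b c d e f g h
  where
  lemma : ∀ a b c d e f g h → e * h - f * g ≡
    a * d - b * c + ((a + e) * (d + h) - (b + f) * (c + g))
      - (a * (d + h) - b * (c + g) - c * (b + f) + d * (a + e))
  lemma = solve-∀

tr-+ : ∀ X Y → tr (X +ₘ Y) ≡ tr X + tr Y
tr-+ (mat a b c d) (mat e f g h) = lemma a d e h
  where
  lemma : ∀ a d e h → a + e + (d + h) ≡ a + d + (e + h)
  lemma = solve-∀

+ₘ-comm : ∀ X Y → X +ₘ Y ≡ Y +ₘ X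
+ₘ-comm (mat a b c d) (mat e f g h) = mat≡ (+-comm a e) (+-comm b f) (+-comm c g) (+-comm d h)

-- Cayley-Hamilton gives X² = xX - δ and Y² = yY - ε; expand bilinearly with ⟨X, 1⟩ = x and ⟨1, 1⟩ =
-- 2. The factor xy of ⟨X, Y⟩ is the source of the divisibilities.
⟨²,²⟩ : ∀ X Y → ⟨ X · X , Y · Y ⟩ ≡
  tr X * tr Y * ⟨ X , Y ⟩ - det Y * (tr X * tr X) - det X * (tr Y * tr Y) + + 2 * (det X * det Y)
⟨²,²⟩ (mat a b c d) (mat e f g h) = lemma a b c d e f g h
  where
  lemma : ∀ a b c d e f g h →
    (a * a + b * c) * (g * f + h * h) - (a * b + b * d) * (g * e + h * g)
      - (c * a + d * c) * (e * f + f * h) + (c * b + d * d) * (e * e + f * g) ≡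
    (a + d) * (e + h) * (a * h - b * g - c * f + d * e)
      - (e * h - f * g) * ((a + d) * (a + d)) - (a * d - b * c) * ((e + h) * (e + h))
      + + 2 * ((a * d - b * c) * (e * h - f * g))
  lemma = solve-∀

-- Conjugation

conj-inverse : ∀ {P} (P∈G : P ∈ G) → proj₁ P∈G ∈ G
conj-inverse {P} (Q , QP≡1 , PQ≡1) = P , PQ≡1 , QP≡1

·-∈G : ∀ {P Q} → P ∈ G → Q ∈ G → P · Q ∈ G
·-∈G {P} {Q} (P⁻ , P⁻P≡1 , PP⁻≡1) (Q⁻ , Q⁻Q≡1 , QQ⁻≡1) =
  Q⁻ · P⁻ , cancel Q⁻ P⁻ P Q P⁻P≡1 Q⁻Q≡1 , cancel P Q Q⁻ P⁻ QQ⁻≡1 PP⁻≡1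
  where
  open ≡-Reasoning
  cancel : ∀ A B C D → B · C ≡ 1ₘ → A · D ≡ 1ₘ → A · B · (C · D) ≡ 1ₘ
  cancel A B C D BC≡1 AD≡1 = begin
    A · B · (C · D)   ≡⟨ ·-assoc A B (C · D) ⟩
    A · (B · (C · D)) ≡⟨ cong (A ·_) (·-assoc B C D) ⟨
    A · (B · C · D)   ≡⟨ cong (λ K → A · (K · D)) BC≡1 ⟩
    A · (1ₘ · D)      ≡⟨ cong (A ·_) (·-identityˡ D) ⟩
    A · D             ≡⟨ AD≡1 ⟩
    1ₘ                ∎

module _ {P} (P∈G : P ∈ G) where
  open ≡-Reasoning
  private
    P⁻ = proj₁ P∈G
    P⁻P≡1 = proj₁ (proj₂ P∈G)
    PP⁻≡1 = proj₂ (proj₂ P∈G)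

  conj-· : ∀ X Y → conj P∈G (X · Y) ≡ conj P∈G X · conj P∈G Y
  conj-· X Y = begin
    P · (X · Y) · P⁻             ≡⟨ cong (_· P⁻) (·-assoc P X Y) ⟨
    P · X · Y · P⁻               ≡⟨ ·-assoc (P · X) Y P⁻ ⟩
    P · X · (Y · P⁻)             ≡⟨ cong (λ K → P · X · (K · P⁻)) (·-identityˡ Y) ⟨
    P · X · (1ₘ · Y · P⁻)        ≡⟨ cong (λ K → P · X · (K · Y · P⁻)) P⁻P≡1 ⟨
    P · X · (P⁻ · P · Y · P⁻)    ≡⟨ cong (λ K → P · X · (K · P⁻)) (·-assoc P⁻ P Y) ⟩
    P · X · (P⁻ · (P · Y) · P⁻)  ≡⟨ cong (P · X ·_) (·-assoc P⁻ (P · Y) P⁻) ⟩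
    P · X · (P⁻ · (P · Y · P⁻))  ≡⟨ ·-assoc (P · X) P⁻ (P · Y · P⁻) ⟨
    P · X · P⁻ · (P · Y · P⁻)    ∎

  conj-+ : ∀ X Y → conj P∈G (X +ₘ Y) ≡ conj P∈G X +ₘ conj P∈G Y
  conj-+ X Y = trans (cong (_· P⁻) (·-distribˡ P X Y)) (·-distribʳ P⁻ (P · X) (P · Y))

  conj-1 : conj P∈G 1ₘ ≡ 1ₘ
  conj-1 = trans (cong (_· P⁻) (·-identityʳ P)) PP⁻≡1

  conj-∈G : ∀ {X} → X ∈ G → conj P∈G X ∈ G
  conj-∈G {X} (X⁻ , X⁻X≡1 , XX⁻≡1) = conj P∈G X⁻ ,
    trans (sym (conj-· X⁻ X)) (trans (cong (conj P∈G) X⁻X≡1) conj-1) ,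
    trans (sym (conj-· X X⁻)) (trans (cong (conj P∈G) XX⁻≡1) conj-1)

  tr-conj : ∀ X → tr (conj P∈G X) ≡ tr X
  tr-conj X = begin
    tr (P · X · P⁻)   ≡⟨ tr-comm (P · X) P⁻ ⟩
    tr (P⁻ · (P · X)) ≡⟨ cong tr (·-assoc P⁻ P X) ⟨
    tr (P⁻ · P · X)   ≡⟨ cong (λ K → tr (K · X)) P⁻P≡1 ⟩
    tr (1ₘ · X)       ≡⟨ cong tr (·-identityˡ X) ⟩
    tr X              ∎

  det-conj : ∀ X → det (conj P∈G X) ≡ det X
  det-conj X = begin
    det (P · X · P⁻)       ≡⟨ det-· (P · X) P⁻ ⟩
    det (P · X) * det P⁻   ≡⟨ cong (_* det P⁻) (det-· P X) ⟩
    det P * det X * det P⁻ ≡⟨ rotate (det P) (det X) (det P⁻) ⟩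
    det X * (det P * det P⁻) ≡⟨ cong (det X *_) (trans (sym (det-· P P⁻)) (cong det PP⁻≡1)) ⟩
    det X * 1ℤ               ≡⟨ *-identityʳ (det X) ⟩
    det X                    ∎
    where
    rotate : ∀ p x q → p * x * q ≡ x * (p * q)
    rotate = solve-∀

  conj⁻¹-conj : ∀ X → conj (conj-inverse P∈G) (conj P∈G X) ≡ X
  conj⁻¹-conj X = begin
    P⁻ · (P · X · P⁻) · P   ≡⟨ ·-assoc P⁻ (P · X · P⁻) P ⟩
    P⁻ · (P · X · P⁻ · P)   ≡⟨ cong (P⁻ ·_) (·-assoc (P · X) P⁻ P) ⟩
    P⁻ · (P · X · (P⁻ · P)) ≡⟨ cong (λ K → P⁻ · (P · X · K)) P⁻P≡1 ⟩
    P⁻ · (P · X · 1ₘ)       ≡⟨ cong (P⁻ ·_) (·-identityʳ (P · X)) ⟩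
    P⁻ · (P · X)            ≡⟨ ·-assoc P⁻ P X ⟨
    P⁻ · P · X              ≡⟨ cong (_· X) P⁻P≡1 ⟩
    1ₘ · X                  ≡⟨ ·-identityˡ X ⟩
    X                       ∎

  conj-intertwines : ∀ {X Y} → conj P∈G X ≡ Y → P · X ≡ Y · P
  conj-intertwines {X} {Y} refl = begin
    P · X             ≡⟨ ·-identityʳ (P · X) ⟨
    P · X · 1ₘ        ≡⟨ cong (P · X ·_) P⁻P≡1 ⟨
    P · X · (P⁻ · P)  ≡⟨ ·-assoc (P · X) P⁻ P ⟨
    P · X · P⁻ · P    ∎

conj-conj : ∀ {P Q} (P∈G : P ∈ G) (Q∈G : Q ∈ G) X → conj (·-∈G P∈G Q∈G) X ≡ conj P∈G (conj Q∈G X)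
conj-conj {P} {Q} (P⁻ , _) (Q⁻ , _) X = begin
  P · Q · X · (Q⁻ · P⁻)   ≡⟨ cong (_· (Q⁻ · P⁻)) (·-assoc P Q X) ⟩
  P · (Q · X) · (Q⁻ · P⁻) ≡⟨ ·-assoc (P · (Q · X)) Q⁻ P⁻ ⟨
  P · (Q · X) · Q⁻ · P⁻   ≡⟨ cong (_· P⁻) (·-assoc P (Q · X) Q⁻) ⟩
  P · (Q · X · Q⁻) · P⁻   ∎
  where open ≡-Reasoning

triple≡ : ∀ {X Y Z X′ Y′ Z′ : Mat} → X ≡ X′ → Y ≡ Y′ → Z ≡ Z′ → (X , Y , Z) ≡ (X′ , Y′ , Z′)
triple≡ refl refl refl = refl

𝒪-sym : ∀ {s t} → t ∈ 𝒪 s → s ∈ 𝒪 t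
𝒪-sym {X , Y , Z} (P , P∈G , refl) = _ , conj-inverse P∈G ,
  triple≡ (sym (conj⁻¹-conj P∈G X)) (sym (conj⁻¹-conj P∈G Y)) (sym (conj⁻¹-conj P∈G Z))

𝒪-trans : ∀ {r s t} → t ∈ 𝒪 s → s ∈ 𝒪 r → t ∈ 𝒪 r
𝒪-trans {X , Y , Z} (P , P∈G , refl) (Q , Q∈G , refl) = _ , ·-∈G P∈G Q∈G ,
  triple≡ (sym (conj-conj P∈G Q∈G X)) (sym (conj-conj P∈G Q∈G Y)) (sym (conj-conj P∈G Q∈G Z))

ℳ-conj : ∀ {s t} → s ∈ ℳ → t ∈ 𝒪 s → t ∈ ℳ
ℳ-conj {X , Y , Z} ((X∈G , Y∈G , Z∈G) , eq , 0≤x , 0≤y , 0≤z) (P , P∈G , refl) =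
  (conj-∈G P∈G X∈G , conj-∈G P∈G Y∈G , conj-∈G P∈G Z∈G) , eq′ ,
  tr≥0 X 0≤x , tr≥0 Y 0≤y , tr≥0 Z 0≤z
  where
  tr≥0 : ∀ X → 0ℤ ≤ tr X → 0ℤ ≤ tr (conj P∈G X)
  tr≥0 X = subst (0ℤ ≤_) (sym (tr-conj P∈G X))
  open ≡-Reasoning
  eq′ : conj P∈G X · conj P∈G X +ₘ conj P∈G Y · conj P∈G Y ≡ conj P∈G Z · conj P∈G Z
  eq′ = begin
    conj P∈G X · conj P∈G X +ₘ conj P∈G Y · conj P∈G Y ≡⟨ cong₂ _+ₘ_ (conj-· P∈G X X) (conj-· P∈G Y Y) ⟨
    conj P∈G (X · X) +ₘ conj P∈G (Y · Y)               ≡⟨ conj-+ P∈G (X · X) (Y · Y) ⟨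
    conj P∈G (X · X +ₘ Y · Y)                          ≡⟨ cong (conj P∈G) eq ⟩
    conj P∈G (Z · Z)                                   ≡⟨ conj-· P∈G Z Z ⟩
    conj P∈G Z · conj P∈G Z                            ∎

det-sign : ∀ {X} → X ∈ G → Sign (det X)
det-sign {X} (X⁻ , _ , XX⁻≡1) = abs-sign (det X)
  (ℕ.m*n≡1⇒m≡1 ∣ det X ∣ ∣ det X⁻ ∣
    (trans (sym (abs-* (det X) (det X⁻))) (cong ∣_∣ (trans (sym (det-· X X⁻)) (cong det XX⁻≡1)))))
  where
  abs-sign : ∀ i → ∣ i ∣ ≡ 1 → Sign i
  abs-sign (+ 1) refl = inj₁ refl
  abs-sign -[1+ 0 ] refl = inj₂ refl

det-²+² : ∀ X Y → det (X · X +ₘ Y · Y) ≡ det X * det X + det Y * det Y +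
  (tr X * tr Y * ⟨ X , Y ⟩ - det Y * (tr X * tr X) - det X * (tr Y * tr Y) + + 2 * (det X * det Y))
det-²+² X Y = trans (det-+ (X · X) (Y · Y))
  (cong₂ _+_ (cong₂ _+_ (det-· X X) (det-· Y Y)) (⟨²,²⟩ X Y))

det-²-² : ∀ X Y Z → X · X +ₘ Y · Y ≡ Z · Z → det Y * det Y ≡ det X * det X + det Z * det Z -
  (tr X * tr Z * ⟨ X , Z ⟩ - det Z * (tr X * tr X) - det X * (tr Z * tr Z) + + 2 * (det X * det Z))
det-²-² X Y Z eq = begin
  det Y * det Y                                                    ≡⟨ det-· Y Y ⟨
  det (Y · Y)                                                      ≡⟨ det-summand (X · X) (Y · Y) ⟩
  det (X · X) + det (X · X +ₘ Y · Y) - ⟨ X · X , X · X +ₘ Y · Y ⟩ ≡⟨ cong (λ K → det (X · X) + det K - ⟨ X · X , K ⟩) eq ⟩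
  det (X · X) + det (Z · Z) - ⟨ X · X , Z · Z ⟩                   ≡⟨ cong₂ _-_ (cong₂ _+_ (det-· X X) (det-· Z Z)) (⟨²,²⟩ X Z) ⟩
  det X * det X + det Z * det Z -
    (tr X * tr Z * ⟨ X , Z ⟩ - det Z * (tr X * tr X) - det X * (tr Z * tr Z) + + 2 * (det X * det Z)) ∎
  where open ≡-Reasoning

-- The pairings ⟨X, Y⟩, ⟨X, Z⟩, ⟨Y, Z⟩ serve as the quotients in the divisibilities. All squares
-- have determinant 1, so the sum contributes the constant -1 and the differences +1.
ℳ-invariants : ∀ {X Y Z} → (X , Y , Z) ∈ ℳ → Solution (det X) (det Y) (det Z) (tr X) (tr Y) (tr Z)
ℳ-invariants {X} {Y} {Z} ((X∈G , Y∈G , Z∈G) , eq , 0≤x , 0≤y , 0≤z) =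
  trace-equations ⟨ X , Y ⟩ ⟨ X , Z ⟩ ⟨ Y , Z ⟩ sδ sε sζ 0≤x 0≤y 0≤z
    (e₀ (det X) (det Y) (det Z) (tr X) (tr Y) (tr Z)
      (trans (sym (cong₂ _+_ (tr-² X) (tr-² Y))) (trans (sym (tr-+ (X · X) (Y · Y))) (trans (cong tr eq) (tr-² Z)))))
    (e₁ (det X) (det Y) (det Z) (tr X) (tr Y) ⟨ X , Y ⟩ (sign² sδ) (sign² sε) (sign² sζ)
      (trans (sym (det-²+² X Y)) (trans (cong det eq) (det-· Z Z))))
    (e₂ (det X) (det Y) (det Z) (tr X) (tr Z) ⟨ X , Z ⟩ (sign² sδ) (sign² sε) (sign² sζ) (det-²-² X Y Z eq))
    (e₂ (det Y) (det X) (det Z) (tr Y) (tr Z) ⟨ Y , Z ⟩ (sign² sε) (sign² sδ) (sign² sζ)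
      (det-²-² Y X Z (trans (+ₘ-comm (Y · Y) (X · X)) eq)))
  where
  sδ = det-sign X∈G
  sε = det-sign Y∈G
  sζ = det-sign Z∈G
  e₀ : ∀ δ ε ζ x y z → x * x - + 2 * δ + (y * y - + 2 * ε) ≡ z * z - + 2 * ζ →
    x * x + y * y - z * z ≡ + 2 * (δ + ε - ζ)
  e₀ δ ε ζ x y z h = 1ℤ ⊛ h ⊢ solve (δ ∷ ε ∷ ζ ∷ x ∷ y ∷ z ∷ [])
  e₁ : ∀ δ ε ζ x y t → δ * δ ≡ 1ℤ → ε * ε ≡ 1ℤ → ζ * ζ ≡ 1ℤ →
    δ * δ + ε * ε + (x * y * t - ε * (x * x) - δ * (y * y) + + 2 * (δ * ε)) ≡ ζ * ζ →
    x * y * t ≡ ε * (x * x) + δ * (y * y) - + 2 * (δ * ε) - 1ℤ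
  e₁ δ ε ζ x y t δ² ε² ζ² h =
    1ℤ ⊛ h ⊕ -1ℤ ⊛ δ² ⊕ -1ℤ ⊛ ε² ⊕ 1ℤ ⊛ ζ² ⊢ solve (δ ∷ ε ∷ ζ ∷ x ∷ y ∷ t ∷ [])
  e₂ : ∀ δ ε ζ x z u → δ * δ ≡ 1ℤ → ε * ε ≡ 1ℤ → ζ * ζ ≡ 1ℤ →
    ε * ε ≡ δ * δ + ζ * ζ - (x * z * u - ζ * (x * x) - δ * (z * z) + + 2 * (δ * ζ)) →
    x * z * u ≡ ζ * (x * x) + δ * (z * z) - + 2 * (δ * ζ) + 1ℤ
  e₂ δ ε ζ x z u δ² ε² ζ² h =
    1ℤ ⊛ h ⊕ 1ℤ ⊛ δ² ⊕ -1ℤ ⊛ ε² ⊕ 1ℤ ⊛ ζ² ⊢ solve (δ ∷ ε ∷ ζ ∷ x ∷ z ∷ u ∷ [])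

-- Reduction of matrices of trace and determinant 1

infix 4 _∼_
_∼_ : Mat → Mat → Set
X ∼ Y = ∃₂ λ P (P∈G : P ∈ G) → conj P∈G X ≡ Y

∼-trans : ∀ {X Y Z} → X ∼ Y → Y ∼ Z → X ∼ Z
∼-trans {X} (Q , Q∈G , refl) (P , P∈G , refl) = _ , ·-∈G P∈G Q∈G , conj-conj P∈G Q∈G X

-- Clears the inverse, so that conjugacies can be checked by polynomial identities in the entries.
intertwines-conj : ∀ {P} (P∈G : P ∈ G) X Y → P · X ≡ Y · P → conj P∈G X ≡ Y
intertwines-conj {P} (P⁻ , _ , PP⁻≡1) X Y PX≡YP =
  trans (cong (_· P⁻) PX≡YP) (trans (·-assoc Y P P⁻) (trans (cong (Y ·_) PP⁻≡1) (·-identityʳ Y)))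

∼-shear : ∀ k a b c d → mat a b c d ∼ mat (a + k * c) (b + k * d - k * (a + k * c)) c (d - k * c)
∼-shear k a b c d = mat 1ℤ k 0ℤ 1ℤ , shear∈G , intertwines-conj shear∈G
  (mat a b c d) (mat (a + k * c) (b + k * d - k * (a + k * c)) c (d - k * c))
  (mat≡ (e₁₁≡ k a b c d) (e₁₂≡ k a b c d) (e₂₁≡ k a c d) (e₂₂≡ k b c d))
  where
  e₁₁≡ : ∀ k a b c d → 1ℤ * a + k * c ≡ (a + k * c) * 1ℤ + (b + k * d - k * (a + k * c)) * 0ℤ
  e₁₁≡ = solve-∀
  e₁₂≡ : ∀ k a b c d → 1ℤ * b + k * d ≡ (a + k * c) * k + (b + k * d - k * (a + k * c)) * 1ℤ
  e₁₂≡ = solve-∀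
  e₂₁≡ : ∀ k a c d → 0ℤ * a + 1ℤ * c ≡ c * 1ℤ + (d - k * c) * 0ℤ
  e₂₁≡ = solve-∀
  e₂₂≡ : ∀ k b c d → 0ℤ * b + 1ℤ * d ≡ c * k + (d - k * c) * 1ℤ
  e₂₂≡ = solve-∀
  left : ∀ k → 1ℤ * - k + k * 1ℤ ≡ 0ℤ
  left = solve-∀
  right : ∀ k → 1ℤ * k + - k * 1ℤ ≡ 0ℤ
  right = solve-∀
  e₁₁≡1 : ∀ k → 1ℤ * 1ℤ + k * 0ℤ ≡ 1ℤ
  e₁₁≡1 = solve-∀
  e₂₂≡1 : ∀ k → 0ℤ * k + 1ℤ * 1ℤ ≡ 1ℤ
  e₂₂≡1 = solve-∀
  shear∈G : mat 1ℤ k 0ℤ 1ℤ ∈ G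
  shear∈G = mat 1ℤ (- k) 0ℤ 1ℤ ,
    mat≡ (e₁₁≡1 (- k)) (right k) refl (e₂₂≡1 k) ,
    mat≡ (e₁₁≡1 k) (left k) refl (e₂₂≡1 (- k))

∼-swap : ∀ a b c d → mat a b c d ∼ mat d c b a
∼-swap a b c d = S , S∈G , intertwines-conj S∈G (mat a b c d) (mat d c b a) (mat≡ (e₁₁≡ a c d) (e₁₂≡ b c d) (e₂₁≡ a b c) (e₂₂≡ a b d))
  where
  S : Mat
  S = mat 0ℤ 1ℤ
          1ℤ 0ℤ
  S∈G : S ∈ G
  S∈G = S , refl , refl
  e₁₁≡ : ∀ a c d → 0ℤ * a + 1ℤ * c ≡ d * 0ℤ + c * 1ℤ
  e₁₁≡ = solve-∀
  e₁₂≡ : ∀ b c d → 0ℤ * b + 1ℤ * d ≡ d * 1ℤ + c * 0ℤ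
  e₁₂≡ = solve-∀
  e₂₁≡ : ∀ a b c → 1ℤ * a + 0ℤ * c ≡ b * 0ℤ + a * 1ℤ
  e₂₁≡ = solve-∀
  e₂₂≡ : ∀ a b d → 1ℤ * b + 0ℤ * d ≡ b * 1ℤ + a * 0ℤ
  e₂₂≡ = solve-∀

∼-flip : ∀ a b c d → mat a b c d ∼ mat a (- b) (- c) d
∼-flip a b c d = K , K∈G , intertwines-conj K∈G (mat a b c d) (mat a (- b) (- c) d) (mat≡ (e₁₁≡ a b c) (e₁₂≡ a b d) (e₂₁≡ a c d) (e₂₂≡ b c d))
  where
  K : Mat
  K = mat 1ℤ 0ℤ
          0ℤ -1ℤ
  K∈G : K ∈ G
  K∈G = K , refl , refl
  e₁₁≡ : ∀ a b c → 1ℤ * a + 0ℤ * c ≡ a * 1ℤ + - b * 0ℤ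
  e₁₁≡ = solve-∀
  e₁₂≡ : ∀ a b d → 1ℤ * b + 0ℤ * d ≡ a * 0ℤ + - b * -1ℤ
  e₁₂≡ = solve-∀
  e₂₁≡ : ∀ a c d → 0ℤ * a + -1ℤ * c ≡ - c * 1ℤ + d * 0ℤ
  e₂₁≡ = solve-∀
  e₂₂≡ : ∀ b c d → 0ℤ * b + -1ℤ * d ≡ - c * 0ℤ + d * -1ℤ
  e₂₂≡ = solve-∀

0≤² : ∀ i → 0ℤ ≤ i * i
0≤² (+ n) = 0≤+ n ∙ 0≤+ n
0≤² -[1+ n ] = +≤+ z≤n

-- A shear keeps the lower left entry 1 and moves the upper left one to 1; trace and determinant
-- then fix the rest.
c≡1⇒∼E : ∀ a b d → a + d ≡ 1ℤ → a * d - b * 1ℤ ≡ 1ℤ → mat a b 1ℤ d ∼ -ₘ (R · R)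
c≡1⇒∼E a b d tr≡1 det≡1 = subst (mat a b 1ℤ d ∼_) (mat≡ e₁₁≡1 e₁₂≡-1 refl e₂₂≡0) (∼-shear (1ℤ - a) a b 1ℤ d)
  where
  e₁₁≡1 : a + (1ℤ - a) * 1ℤ ≡ 1ℤ
  e₁₁≡1 = solve (a ∷ [])
  e₁₂≡-1 : b + (1ℤ - a) * d - (1ℤ - a) * (a + (1ℤ - a) * 1ℤ) ≡ -1ℤ
  e₁₂≡-1 = 1ℤ ⊛ tr≡1 ⊕ -1ℤ ⊛ det≡1 ⊢ solve (a ∷ b ∷ d ∷ [])
  e₂₂≡0 : d - (1ℤ - a) * 1ℤ ≡ 0ℤ
  e₂₂≡0 = 1ℤ ⊛ tr≡1 ⊢ solve (a ∷ d ∷ [])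

-- Euclidean descent on ∣c∣, with n as fuel: a shear replaces a by its remainder modulo c, and a
-- swap brings the new, smaller b to the place of c.
reduce : ∀ n a b c d → a + d ≡ 1ℤ → a * d - b * c ≡ 1ℤ → ∣ c ∣ ℕ.≤ n → mat a b c d ∼ -ₘ (R · R)
descend : ∀ n a b c d .{{_ : NonZero c}} → 0ℤ ≤ + ∣ c ∣ - + 2 →
  a + d ≡ 1ℤ → a * d - b * c ≡ 1ℤ → ∣ c ∣ ℕ.≤ suc n → mat a b c d ∼ -ₘ (R · R)

-- Here a(1 - a) = 1, that is (2a - 1)² = -3.
reduce n a b (+ 0) d tr≡1 det≡1 _ = refute 2 (0≤² (+ 2 * a - 1ℤ))
  (-[1+ 3 ] ⊛ det≡1 ⊕ (+ 4 * a) ⊛ tr≡1 ⊢ solve (a ∷ b ∷ d ∷ []))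
reduce n a b (+ 1) d tr≡1 det≡1 _ = c≡1⇒∼E a b d tr≡1 det≡1
reduce n a b -[1+ 0 ] d tr≡1 det≡1 _ = ∼-trans (∼-flip a b -1ℤ d)
  (c≡1⇒∼E a (- b) d tr≡1 (1ℤ ⊛ det≡1 ⊢ solve (a ∷ b ∷ d ∷ [])))
reduce (suc n) a b c@(+[1+ suc m ]) d = descend n a b c d (0≤+ m)
reduce (suc n) a b c@(-[1+ suc m ]) d = descend n a b c d (0≤+ m)

descend n a b c d 2≤∣c∣ tr≡1 det≡1 ∣c∣≤1+n =
  ∼-trans (∼-shear k a b c d) (∼-trans (∼-swap _ _ _ _) (reduce n d′ c b′ a′
    (trans (tr≡ k a c d) tr≡1) (trans (det≡ k a b c d) det≡1)
    (ℕ.s≤s⁻¹ (ℕ.≤-trans ∣b′∣<∣c∣ ∣c∣≤1+n))))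
  where
  k = - (a / c)
  a′ = a + k * c
  b′ = b + k * d - k * (a + k * c)
  d′ = d - k * c
  r = a % c

  tr≡ : ∀ k a c d → d - k * c + (a + k * c) ≡ a + d
  tr≡ = solve-∀

  det≡ : ∀ k a b c d → (d - k * c) * (a + k * c) - c * (b + k * d - k * (a + k * c)) ≡ a * d - b * c
  det≡ = solve-∀

  a′≡r : a + k * c ≡ + r
  a′≡r = lemma a (+ r) (a / c) c (a≡a%n+[a/n]*n a c)
    where
    lemma : ∀ a r q c → a ≡ r + q * c → a + - q * c ≡ r
    lemma a r q c h = 1ℤ ⊛ h ⊢ solve (a ∷ r ∷ q ∷ c ∷ [])

  -- With a′ = r and d′ = 1 - r the determinant reads -b′c = r² - r + 1. This is positive and, as 0
  -- ≤ r < ∣c∣ and ∣c∣ ≥ 2, below ∣c∣²; hence ∣b′∣ < ∣c∣.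
  b′c : - ((b + k * d - k * (a + k * c)) * c) ≡ + r * + r - + r + 1ℤ
  b′c = lemma a b c d k (+ r) a′≡r tr≡1 det≡1
    where
    lemma : ∀ a b c d k r → a + k * c ≡ r → a + d ≡ 1ℤ → a * d - b * c ≡ 1ℤ →
      - ((b + k * d - k * (a + k * c)) * c) ≡ r * r - r + 1ℤ
    lemma a b c d k r a′≡r tr≡1 det≡1 =
      (a + k * c + r - 1ℤ) ⊛ a′≡r ⊕ - (a + k * c) ⊛ tr≡1 ⊕ 1ℤ ⊛ det≡1
      ⊢ solve (a ∷ b ∷ c ∷ d ∷ k ∷ r ∷ [])

  ∣b′∣∣c∣ : + ∣ b′ ∣ * + ∣ c ∣ ≡ + r * + r - + r + 1ℤ
  ∣b′∣∣c∣ = begin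
    + ∣ b′ ∣ * + ∣ c ∣        ≡⟨ pos-* ∣ b′ ∣ ∣ c ∣ ⟨
    + (∣ b′ ∣ ℕ.* ∣ c ∣)      ≡⟨ cong +_ (abs-* b′ c) ⟨
    + ∣ b′ * c ∣              ≡⟨ cong +_ (∣-i∣≡∣i∣ (b′ * c)) ⟨
    + ∣ - (b′ * c) ∣          ≡⟨ 0≤i⇒+∣i∣≡i (subst (0ℤ ≤_) (sym b′c) (positive (+ r) (0≤+ r))) ⟩
    - (b′ * c)                ≡⟨ b′c ⟩
    + r * + r - + r + 1ℤ      ∎
    where
    open ≡-Reasoning
    positive : ∀ r → 0ℤ ≤ r → 0ℤ ≤ r * r - r + 1ℤ
    positive r 0≤r = 0≤² (r - 1ℤ) ∔ 0≤r by solve (r ∷ [])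

  ∣b′∣<∣c∣ : ∣ b′ ∣ ℕ.< ∣ c ∣
  ∣b′∣<∣c∣ = drop‿+≤+ (0≤i-j⇒j≤i
    (lemma (+ ∣ b′ ∣) (+ ∣ c ∣) (+ r) ∣b′∣∣c∣ (0≤+ r) (i≤j⇒0≤j-i (+≤+ (n%d<d a c))) 2≤∣c∣))
    where
    lemma : ∀ B C r → B * C ≡ r * r - r + 1ℤ → 0ℤ ≤ r → 0ℤ ≤ C - (1ℤ + r) → 0ℤ ≤ C - + 2 →
      0ℤ ≤ C - (1ℤ + B)
    lemma B C r BC 0≤r r<C 2≤C = by-contra λ C≤B → refute 0
      (C≤B ∙ (2≤C ∔ 0≤+ 2) ∔ r<C ∙ (2≤C ∔ 0≤+ 2 ∔ 0≤r) ∔ 0≤+ 2 ∙ 0≤r ∔ 2≤C)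
      (1ℤ ⊛ BC ⊢ solve (B ∷ C ∷ r ∷ []))

reduce-order-six : ∀ X → tr X ≡ 1ℤ → det X ≡ 1ℤ → X ∼ -ₘ (R · R)
reduce-order-six (mat a b c d) tr≡1 det≡1 = reduce ∣ c ∣ a b c d tr≡1 det≡1 ℕ.≤-refl

-- Classification

E : Mat
E = -ₘ (R · R)

-- Every traceless matrix has this form, with determinant ab + bc + ca.
⟦_,_,_⟧ : ℤ → ℤ → ℤ → Mat
⟦ a , b , c ⟧ = mat a (- a - c) (a + b) (- a)

n²+1≢3k : ∀ n k → n * n + 1ℤ ≢ + 3 * k
n²+1≢3k n k h = remainders (+ r) (0≤+ r) (i≤j⇒0≤j-i (+≤+ (ℕ.s≤s⁻¹ (n%d<d n (+ 3)))))
  (divides (k - + 3 * (q * q) - + 2 * (+ r * q)) (lemma n k q (+ r) h (a≡a%n+[a/n]*n n (+ 3))))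
  where
  q = n / + 3
  r = n % + 3
  lemma : ∀ n k q r → n * n + 1ℤ ≡ + 3 * k → n ≡ r + q * + 3 →
    r * r + 1ℤ ≡ (k - + 3 * (q * q) - + 2 * (r * q)) * + 3
  lemma n k q r h n≡ = 1ℤ ⊛ h ⊕ - (n + r + q * + 3) ⊛ n≡ ⊢ solve (n ∷ k ∷ q ∷ r ∷ [])
  remainders : ∀ r → 0ℤ ≤ r → 0ℤ ≤ + 2 - r → ¬ (+ 3 ∣ r * r + 1ℤ)
  remainders = from-yes (∀≤? 2 λ r → ¬? (+ 3 ∣? r * r + 1ℤ))

between : ∀ i → 0ℤ ≤ 1ℤ + i → 0ℤ ≤ 1ℤ - i → i ≡ 0ℤ ⊎ Sign i
between (+ 0) _ _ = inj₁ refl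
between (+ 1) _ _ = inj₂ (inj₁ refl)
between -[1+ 0 ] _ _ = inj₂ (inj₂ refl)

-- Four times the equation is (2p - r)² + 3r² = 4.
eisenstein-bound : ∀ p r → p * p - p * r + r * r ≡ 1ℤ → r ≡ 0ℤ ⊎ Sign r
eisenstein-bound p r h = between r
  (by-contra λ r≤-2 → refute 7 (0≤+ 3 ∙ (r≤-2 ∙ (r≤-2 ∔ 0≤+ 4)) ∔ 0≤² (+ 2 * p - r)) (+ 4 ⊛ h ⊢ solve (p ∷ r ∷ [])))
  (by-contra λ 2≤r → refute 7 (0≤+ 3 ∙ (2≤r ∙ (2≤r ∔ 0≤+ 4)) ∔ 0≤² (+ 2 * p - r)) (+ 4 ⊛ h ⊢ solve (p ∷ r ∷ [])))

-- These are the six units of the Eisenstein integers: for the matrix p + rR the alternatives are σ,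
-- σR and -σR².
eisenstein-units : ∀ p r → p * p - p * r + r * r ≡ 1ℤ →
  ∃ λ σ → Sign σ × ((p ≡ σ × r ≡ 0ℤ) ⊎ (p ≡ 0ℤ × r ≡ σ) ⊎ (p ≡ σ × r ≡ σ))
eisenstein-units p r h with eisenstein-bound r p (1ℤ ⊛ h ⊢ solve (p ∷ r ∷ [])) | eisenstein-bound p r h
eisenstein-units _ _ () | inj₁ refl | inj₁ refl
... | inj₁ p≡0 | inj₂ sr = r , sr , inj₂ (inj₁ (p≡0 , refl))
... | inj₂ sp | inj₁ r≡0 = p , sp , inj₁ (refl , r≡0)
eisenstein-units _ _ _ | inj₂ sp@(inj₁ refl) | inj₂ (inj₁ refl) = _ , sp , inj₂ (inj₂ (refl , refl))
eisenstein-units _ _ _ | inj₂ sp@(inj₂ refl) | inj₂ (inj₂ refl) = _ , sp , inj₂ (inj₂ (refl , refl))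
eisenstein-units _ _ () | inj₂ (inj₁ refl) | inj₂ (inj₂ refl)
eisenstein-units _ _ () | inj₂ (inj₂ refl) | inj₂ (inj₁ refl)

-- Triples whose first entry is `E`

R∈G : R ∈ G
R∈G = R · R , refl , refl

𝒪-refl : ∀ t → t ∈ 𝒪 t
𝒪-refl (X , Y , Z) = 1ₘ , 1∈G , triple≡ (fixed X) (fixed Y) (fixed Z)
  where
  1∈G : 1ₘ ∈ G
  1∈G = 1ₘ , refl , refl
  fixed : ∀ X → X ≡ conj 1∈G X
  fixed X = sym (trans (·-identityʳ (1ₘ · X)) (·-identityˡ X))

rotate : ∀ a b c → (E , -ₘ R , ⟦ b , c , a ⟧) ∈ 𝒪 (E , -ₘ R , ⟦ a , b , c ⟧)
rotate a b c = R , R∈G , triple≡ refl refl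
  (sym (intertwines-conj R∈G ⟦ a , b , c ⟧ ⟦ b , c , a ⟧ (mat≡ (e₁₁≡ a b) (e₁₂≡ a b c) (e₂₁≡ a b c) (e₂₂≡ a b c))))
  where
  e₁₁≡ : ∀ a b → 0ℤ * a + -1ℤ * (a + b) ≡ b * 0ℤ + (- b - a) * 1ℤ
  e₁₁≡ = solve-∀
  e₁₂≡ : ∀ a b c → 0ℤ * (- a - c) + -1ℤ * - a ≡ b * -1ℤ + (- b - a) * -1ℤ
  e₁₂≡ = solve-∀
  e₂₁≡ : ∀ a b c → 1ℤ * a + -1ℤ * (a + b) ≡ (b + c) * 0ℤ + - b * 1ℤ
  e₂₁≡ = solve-∀
  e₂₂≡ : ∀ a b c → 1ℤ * (- a - c) + -1ℤ * - a ≡ (b + c) * -1ℤ + - b * -1ℤ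
  e₂₂≡ = solve-∀

cyclic : ∀ a b c → a * b + b * c + c * a ≡ b * c + c * a + a * b
cyclic = solve-∀

-- Rotate to the front a minimum whose cyclic predecessor is strictly larger; this explains the
-- mixed inequalities a ≤ b, a < c. It exists unless all three are equal, and then 3a² = 1.
third-in-𝒯 : ∀ a b c → a * b + b * c + c * a ≡ 1ℤ →
  ∃ λ T → T ∈ 𝒯 × (E , -ₘ R , ⟦ a , b , c ⟧) ∈ 𝒪 (E , -ₘ R , T)
third-in-𝒯 a b c h with a ≤? b | a <? c | b ≤? c | c <? b
... | yes a≤b | yes a<c | _ | _ = ⟦ a , b , c ⟧ , (a , b , c , h , a≤b , a<c , refl) , 𝒪-refl _
... | yes a≤b | no a≮c | _ | yes c<b = ⟦ c , a , b ⟧ ,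
  (c , a , b , trans (cyclic c a b) h , ≮⇒≥ a≮c , c<b , refl) , rotate c a b
... | no a≰b | _ | yes b≤c | _ = ⟦ b , c , a ⟧ ,
  (b , c , a , trans (sym (cyclic a b c)) h , b≤c , ≰⇒> a≰b , refl) , 𝒪-sym (rotate a b c)
... | no a≰b | _ | no b≰c | _ = ⟦ c , a , b ⟧ ,
  (c , a , b , trans (cyclic c a b) h , <⇒≤ (<-trans (≰⇒> b≰c) (≰⇒> a≰b)) , ≰⇒> b≰c , refl) , rotate c a b
... | yes a≤b | no a≮c | _ | no c≮b = contradiction h (all-equal (≤-antisym c≤a a≤c) (≤-antisym (≤-trans b≤c c≤a) a≤b))
  where
  b≤c : b ≤ c
  b≤c = ≮⇒≥ c≮b
  c≤a : c ≤ a
  c≤a = ≮⇒≥ a≮c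
  a≤c : a ≤ c
  a≤c = ≤-trans a≤b b≤c
  all-equal : ∀ {a b c} → c ≡ a → b ≡ a → a * b + b * c + c * a ≢ 1ℤ
  all-equal {a} refl refl h = by-cases (a * a - 1ℤ)
    (λ 1≤a² → refute 1 (0≤+ 3 ∙ 1≤a²) (1ℤ ⊛ h ⊢ solve (a ∷ [])))
    (λ a²≤0 → refute 0 (0≤+ 3 ∙ a²≤0) (-1ℤ ⊛ h ⊢ solve (a ∷ [])))

-- By Cayley-Hamilton E² = E - 1, Y² = Y - 1 and Z² = -1, so the equation becomes linear: Y = 1 - E
-- = -R. Z is any traceless matrix of determinant 1.
elliptic : ∀ Y Z → E · E +ₘ Y · Y ≡ Z · Z →
  tr Y ≡ 1ℤ → det Y ≡ 1ℤ → tr Z ≡ 0ℤ → det Z ≡ 1ℤ →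
  ∃ λ T → T ∈ 𝒯 × (E , Y , Z) ∈ 𝒪 (E , -ₘ R , T)
elliptic (mat a b c d) (mat e f g h) eq trY≡1 detY≡1 trZ≡0 detZ≡1 =
  subst (λ t → ∃ λ T → T ∈ 𝒯 × t ∈ 𝒪 (E , -ₘ R , T)) (sym (triple≡ refl Y≡-R Z≡))
    (third-in-𝒯 e (g - e) (- e - f) norm≡1)
  where
  trY : a + d ≡ 1ℤ
  trY = trY≡1
  detY : a * d - b * c ≡ 1ℤ
  detY = detY≡1
  trZ : e + h ≡ 0ℤ
  trZ = trZ≡0
  detZ : e * h - f * g ≡ 1ℤ
  detZ = detZ≡1
  norm≡1 : e * (g - e) + (g - e) * (- e - f) + (- e - f) * e ≡ 1ℤ
  norm≡1 = - e ⊛ trZ ⊕ 1ℤ ⊛ detZ ⊢ solve (e ∷ f ∷ g ∷ h ∷ [])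
  eq₁₁ : 0ℤ + (a * a + b * c) ≡ e * e + f * g
  eq₁₁ = cong e₁₁ eq
  eq₁₂ : -1ℤ + (a * b + b * d) ≡ e * f + f * h
  eq₁₂ = cong e₁₂ eq
  eq₂₁ : 1ℤ + (c * a + d * c) ≡ g * e + h * g
  eq₂₁ = cong e₂₁ eq
  a≡0 : a ≡ 0ℤ
  a≡0 = 1ℤ ⊛ eq₁₁ ⊕ - a ⊛ trY ⊕ 1ℤ ⊛ detY ⊕ e ⊛ trZ ⊕ -1ℤ ⊛ detZ
    ⊢ solve (a ∷ b ∷ c ∷ d ∷ e ∷ f ∷ g ∷ h ∷ [])
  b≡1 : b ≡ 1ℤ
  b≡1 = 1ℤ ⊛ eq₁₂ ⊕ - b ⊛ trY ⊕ f ⊛ trZ ⊢ solve (a ∷ b ∷ d ∷ e ∷ f ∷ h ∷ [])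
  c≡-1 : c ≡ -1ℤ
  c≡-1 = 1ℤ ⊛ eq₂₁ ⊕ - c ⊛ trY ⊕ g ⊛ trZ ⊢ solve (a ∷ c ∷ d ∷ e ∷ g ∷ h ∷ [])
  d≡1 : d ≡ 1ℤ
  d≡1 = 1ℤ ⊛ trY ⊕ -1ℤ ⊛ a≡0 ⊢ solve (a ∷ d ∷ [])
  Y≡-R : mat a b c d ≡ -ₘ R
  Y≡-R = mat≡ a≡0 b≡1 c≡-1 d≡1
  f≡ : f ≡ - e - (- e - f)
  f≡ = solve (e ∷ f ∷ [])
  g≡ : g ≡ e + (g - e)
  g≡ = solve (e ∷ g ∷ [])
  h≡ : h ≡ - e
  h≡ = 1ℤ ⊛ trZ ⊢ solve (e ∷ h ∷ [])
  Z≡ : mat e f g h ≡ ⟦ e , g - e , - e - f ⟧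
  Z≡ = mat≡ refl f≡ g≡ h≡

-- Triples whose second entry is `E`

module Parabolic where

  -- Since X² = X + 1, E² = E − 1 and Z² = 2Z − 1, the equation is X + E + 1 = 2Z;
  -- with det X = −1 and det Z = 1 this leaves the parameters m = Z₁₁ − 1, f = Z₁₂.
  X[_,_] Z[_,_] : ℤ → ℤ → Mat
  X[ m , f ] = mat (+ 2 * m) (+ 2 * f + 1ℤ) (+ 2 * (m + f) + 1ℤ) (1ℤ - + 2 * m)
  Z[ m , f ] = mat (m + 1ℤ) f (m + f + 1ℤ) (1ℤ - m)

  -- Four times the equation is (2m + f)² + 3f² + 4f = 0, which leaves f = 0 or f = -1.
  integer-points : ∀ m f → m * m + m * f + f * f + f ≡ 0ℤ →
    (m ≡ 0ℤ × f ≡ 0ℤ) ⊎ (m ≡ 0ℤ × f ≡ -1ℤ) ⊎ (m ≡ 1ℤ × f ≡ -1ℤ)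
  integer-points m f h = points m f h (f-range f 0≤1+f f≤0)
    where
    0≤1+f : 0ℤ ≤ 1ℤ + f
    0≤1+f = by-contra λ f≤-2 → refute 3
      (0≤+ 3 ∙ (f≤-2 ∙ f≤-2) ∔ 0≤+ 8 ∙ f≤-2 ∔ 0≤² (+ 2 * m + f)) (+ 4 ⊛ h ⊢ solve (m ∷ f ∷ []))
    f≤0 : 0ℤ ≤ 0ℤ - f
    f≤0 = by-contra λ 1≤f → refute 6
      (0≤+ 3 ∙ (1≤f ∙ 1≤f) ∔ 0≤+ 10 ∙ 1≤f ∔ 0≤² (+ 2 * m + f)) (+ 4 ⊛ h ⊢ solve (m ∷ f ∷ []))
    f-range : ∀ f → 0ℤ ≤ 1ℤ + f → 0ℤ ≤ 0ℤ - f → f ≡ 0ℤ ⊎ f ≡ -1ℤ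
    f-range (+ 0) _ _ = inj₁ refl
    f-range -[1+ 0 ] _ _ = inj₂ refl
    m²≡0 : ∀ m → m * m + m * 0ℤ + 0ℤ * 0ℤ + 0ℤ ≡ 0ℤ → m * m ≡ 0ℤ
    m²≡0 m h = 1ℤ ⊛ h ⊢ solve (m ∷ [])
    m[m-1]≡0 : ∀ m → m * m + m * -1ℤ + -1ℤ * -1ℤ + -1ℤ ≡ 0ℤ → m * (m - 1ℤ) ≡ 0ℤ
    m[m-1]≡0 m h = 1ℤ ⊛ h ⊢ solve (m ∷ [])
    points : ∀ m f → m * m + m * f + f * f + f ≡ 0ℤ → f ≡ 0ℤ ⊎ f ≡ -1ℤ →
      (m ≡ 0ℤ × f ≡ 0ℤ) ⊎ (m ≡ 0ℤ × f ≡ -1ℤ) ⊎ (m ≡ 1ℤ × f ≡ -1ℤ)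
    points m _ h (inj₁ refl) = inj₁ ([ id , id ]′ (i*j≡0⇒i≡0∨j≡0 m (m²≡0 m h)) , refl)
    points m _ h (inj₂ refl) = inj₂
      ([ (λ m≡0 → inj₁ (m≡0 , refl)) , (λ m-1≡0 → inj₂ (i-j≡0⇒i≡j m 1ℤ m-1≡0 , refl)) ]′
        (i*j≡0⇒i≡0∨j≡0 m (m[m-1]≡0 m h)))

  X[]∈𝒪 : ∀ m f → (m ≡ 0ℤ × f ≡ 0ℤ) ⊎ (m ≡ 0ℤ × f ≡ -1ℤ) ⊎ (m ≡ 1ℤ × f ≡ -1ℤ) →
    (X[ m , f ] , E , Z[ m , f ]) ∈ 𝒪 (U , V , W)
  -- Conjugation by E permutes the three points: the witnesses are P, EP and E²P for the first P.
  X[]∈𝒪 _ _ (inj₁ (refl , refl)) =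
    mat 1ℤ 0ℤ -1ℤ 1ℤ , (mat 1ℤ 0ℤ 1ℤ 1ℤ , refl , refl) , refl
  X[]∈𝒪 _ _ (inj₂ (inj₁ (refl , refl))) =
    mat (+ 2) -1ℤ 1ℤ 0ℤ , (mat 0ℤ 1ℤ -1ℤ (+ 2) , refl , refl) , refl
  X[]∈𝒪 _ _ (inj₂ (inj₂ (refl , refl))) =
    mat 1ℤ -1ℤ (+ 2) -1ℤ , (mat -1ℤ 1ℤ -[1+ 1 ] 1ℤ , refl , refl) , refl

  parabolic : ∀ X Z → X · X +ₘ E · E ≡ Z · Z →
    tr X ≡ 1ℤ → det X ≡ -1ℤ → tr Z ≡ + 2 → det Z ≡ 1ℤ → (X , E , Z) ∈ 𝒪 (U , V , W)
  parabolic (mat a b c d) (mat e f g h) eq trX≡1 detX≡-1 trZ≡2 detZ≡1 =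
    subst (_∈ 𝒪 (U , V , W)) (sym (triple≡ (mat≡ a≡ b≡ c≡ d≡) refl (mat≡ e≡ refl g≡ h≡)))
      (X[]∈𝒪 (e - 1ℤ) f (integer-points (e - 1ℤ) f conic))
    where
    trX : a + d ≡ 1ℤ
    trX = trX≡1
    detX : a * d - b * c ≡ -1ℤ
    detX = detX≡-1
    trZ : e + h ≡ + 2
    trZ = trZ≡2
    detZ : e * h - f * g ≡ 1ℤ
    detZ = detZ≡1
    eq₁₁ : a * a + b * c + 0ℤ ≡ e * e + f * g
    eq₁₁ = cong e₁₁ eq
    eq₁₂ : a * b + b * d + -1ℤ ≡ e * f + f * h
    eq₁₂ = cong e₁₂ eq
    eq₂₁ : c * a + d * c + 1ℤ ≡ g * e + h * g
    eq₂₁ = cong e₂₁ eq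
    a≡ : a ≡ + 2 * (e - 1ℤ)
    a≡ = 1ℤ ⊛ eq₁₁ ⊕ - a ⊛ trX ⊕ 1ℤ ⊛ detX ⊕ e ⊛ trZ ⊕ -1ℤ ⊛ detZ
      ⊢ solve (a ∷ b ∷ c ∷ d ∷ e ∷ f ∷ g ∷ h ∷ [])
    b≡ : b ≡ + 2 * f + 1ℤ
    b≡ = 1ℤ ⊛ eq₁₂ ⊕ - b ⊛ trX ⊕ f ⊛ trZ ⊢ solve (a ∷ b ∷ d ∷ e ∷ f ∷ h ∷ [])
    c≡′ : c ≡ + 2 * g - 1ℤ
    c≡′ = 1ℤ ⊛ eq₂₁ ⊕ - c ⊛ trX ⊕ g ⊛ trZ ⊢ solve (a ∷ c ∷ d ∷ e ∷ g ∷ h ∷ [])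
    d≡ : d ≡ 1ℤ - + 2 * (e - 1ℤ)
    d≡ = 1ℤ ⊛ trX ⊕ -1ℤ ⊛ a≡ ⊢ solve (a ∷ d ∷ e ∷ [])
    e≡ : e ≡ e - 1ℤ + 1ℤ
    e≡ = solve (e ∷ [])
    h≡ : h ≡ 1ℤ - (e - 1ℤ)
    h≡ = 1ℤ ⊛ trZ ⊢ solve (e ∷ h ∷ [])
    -- With X = 2Z - E - 1, the quadratic terms cancel in 4 det Z - det X, leaving a linear equation
    -- for g.
    2g≡ : + 2 * g ≡ + 2 * (e - 1ℤ + f + 1ℤ)
    2g≡ = -1ℤ ⊛ detX ⊕ d ⊛ a≡ ⊕ (+ 2 * (e - 1ℤ)) ⊛ d≡ ⊕ - c ⊛ b≡ ⊕ - (+ 2 * f + 1ℤ) ⊛ c≡′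
        ⊕ + 4 ⊛ detZ ⊕ (-[1+ 3 ] * e) ⊛ h≡
      ⊢ solve (a ∷ b ∷ c ∷ d ∷ e ∷ f ∷ g ∷ h ∷ [])
    g≡ : g ≡ e - 1ℤ + f + 1ℤ
    g≡ = *-cancelˡ-≡ (+ 2) g (e - 1ℤ + f + 1ℤ) 2g≡
    c≡ : c ≡ + 2 * (e - 1ℤ + f) + 1ℤ
    c≡ = 1ℤ ⊛ c≡′ ⊕ + 2 ⊛ g≡ ⊢ solve (c ∷ e ∷ f ∷ g ∷ [])
    conic : (e - 1ℤ) * (e - 1ℤ) + (e - 1ℤ) * f + f * f + f ≡ 0ℤ
    conic = -1ℤ ⊛ detZ ⊕ e ⊛ h≡ ⊕ - f ⊛ g≡ ⊢ solve (e ∷ f ∷ g ∷ h ∷ [])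

-- Three negative determinants, and passage to arbitrary triples

no-root-of-order-six : ∀ B → tr B ≡ + 3 → det B ≡ 1ℤ → tr (E · B) ≢ -[1+ 2 ]
-- Eliminating s = 3 - p and r = p + q + 3 turns det B = 1 into (p - q)² + 1 = 3 (p - q - pq), and
-- -1 is not a square modulo 3.
no-root-of-order-six (mat p q r s) trB≡3 detB≡1 trEB≡-3 = n²+1≢3k (p - q) (p - q - p * q)
  (-1ℤ ⊛ detB ⊕ p ⊛ trB ⊕ q ⊛ trEB ⊢ solve (p ∷ q ∷ r ∷ s ∷ []))
  where
  trB : p + s ≡ + 3
  trB = trB≡3
  detB : p * s - q * r ≡ 1ℤ
  detB = detB≡1
  trEB : 1ℤ * p + -1ℤ * r + (1ℤ * q + 0ℤ * s) ≡ -[1+ 2 ]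
  trEB = trEB≡-3

-adj-cancel : ∀ A B → det B ≡ 1ℤ → -ₘ (A · adj B) · B ≡ -ₘ A
-adj-cancel (mat a b c d) (mat p q r s) detB = mat≡
  (left a b detB) (right a b detB) (left c d detB) (right c d detB)
  where
  left : ∀ a b → p * s - q * r ≡ 1ℤ → - (a * s + b * - r) * p + - (a * - q + b * p) * r ≡ - a
  left a b h = - a ⊛ h ⊢ solve (a ∷ b ∷ p ∷ q ∷ r ∷ s ∷ [])
  right : ∀ a b → p * s - q * r ≡ 1ℤ → - (a * s + b * - r) * q + - (a * - q + b * p) * s ≡ - b
  right a b h = - b ⊛ h ⊢ solve (a ∷ b ∷ p ∷ q ∷ r ∷ s ∷ [])

tr-adj : ∀ A B → tr (-ₘ (A · adj B)) ≡ - ⟨ A , B ⟩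
tr-adj (mat a b c d) (mat p q r s) = lemma a b c d p q r s
  where
  lemma : ∀ a b c d p q r s → - (a * s + b * - r) + - (c * - q + d * p) ≡ - (a * s - b * r - c * q + d * p)
  lemma = solve-∀

det-adj : ∀ A B → det (-ₘ (A · adj B)) ≡ det A * det B
det-adj (mat a b c d) (mat p q r s) = lemma a b c d p q r s
  where
  lemma : ∀ a b c d p q r s →
    - (a * s + b * - r) * - (c * - q + d * p) - - (a * - q + b * p) * - (c * s + d * - r) ≡
    (a * d - b * c) * (p * s - q * r)
  lemma = solve-∀

tr-neg : ∀ A → tr (-ₘ A) ≡ - tr A
tr-neg (mat a b c d) = sym (neg-distrib-+ a d)

ℳ-swap : ∀ {X Y Z} → (X , Y , Z) ∈ ℳ → (Y , X , Z) ∈ ℳ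
ℳ-swap {X} {Y} ((X∈G , Y∈G , Z∈G) , eq , 0≤x , 0≤y , 0≤z) =
  (Y∈G , X∈G , Z∈G) , trans (+ₘ-comm (Y · Y) (X · X)) eq , 0≤y , 0≤x , 0≤z

𝒪-swap : ∀ {A B C X Y Z} → (X , Y , Z) ∈ 𝒪 (A , B , C) → (Y , X , Z) ∈ 𝒪 (B , A , C)
𝒪-swap (P , P∈G , refl) = P , P∈G , refl

elliptic-orbit : ∀ {X Y Z} → (X , Y , Z) ∈ ℳ →
  tr X ≡ 1ℤ → det X ≡ 1ℤ → tr Y ≡ 1ℤ → det Y ≡ 1ℤ → tr Z ≡ 0ℤ → det Z ≡ 1ℤ →
  ∃ λ T → T ∈ 𝒯 × (X , Y , Z) ∈ 𝒪 (E , -ₘ R , T)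
elliptic-orbit {X} {Y} {Z} t∈ℳ trX detX trY detY trZ detZ =
  let P , P∈G , X∼E = reduce-order-six X trX detX
      _ , eq , _ = ℳ-conj t∈ℳ (P , P∈G , refl)
      T , T∈𝒯 , ∈𝒪 = elliptic (conj P∈G Y) (conj P∈G Z)
        (subst (λ K → K · K +ₘ conj P∈G Y · conj P∈G Y ≡ conj P∈G Z · conj P∈G Z) X∼E eq)
        (trans (tr-conj P∈G Y) trY) (trans (det-conj P∈G Y) detY)
        (trans (tr-conj P∈G Z) trZ) (trans (det-conj P∈G Z) detZ)
  in T , T∈𝒯 , 𝒪-trans (𝒪-sym (P , P∈G , refl))
    (subst (λ K → (K , conj P∈G Y , conj P∈G Z) ∈ 𝒪 (E , -ₘ R , T)) (sym X∼E) ∈𝒪)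

parabolic-orbit : ∀ {X Y Z} → (X , Y , Z) ∈ ℳ →
  tr X ≡ 1ℤ → det X ≡ -1ℤ → tr Y ≡ 1ℤ → det Y ≡ 1ℤ → tr Z ≡ + 2 → det Z ≡ 1ℤ →
  (X , Y , Z) ∈ 𝒪 (U , V , W)
parabolic-orbit {X} {Y} {Z} t∈ℳ trX detX trY detY trZ detZ =
  let P , P∈G , Y∼E = reduce-order-six Y trY detY
      _ , eq , _ = ℳ-conj t∈ℳ (P , P∈G , refl)
      ∈𝒪 = Parabolic.parabolic (conj P∈G X) (conj P∈G Z)
        (subst (λ K → conj P∈G X · conj P∈G X +ₘ K · K ≡ conj P∈G Z · conj P∈G Z) Y∼E eq)
        (trans (tr-conj P∈G X) trX) (trans (det-conj P∈G X) detX)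
        (trans (tr-conj P∈G Z) trZ) (trans (det-conj P∈G Z) detZ)
  in 𝒪-trans (𝒪-sym (P , P∈G , refl))
    (subst (λ K → (conj P∈G X , K , conj P∈G Z) ∈ 𝒪 (U , V , W)) (sym Y∼E) ∈𝒪)

-- M is -AB⁻¹. Moving it to `E` turns tr (MB) = -3 into the trace condition excluded by
-- `no-root-of-order-six`.
order-six-quotient : ∀ A B M → M · B ≡ -ₘ A → tr M ≡ 1ℤ → det M ≡ 1ℤ →
  tr A ≡ + 3 → tr B ≡ + 3 → det B ≢ 1ℤ
order-six-quotient A B M MB≡-A trM detM trA trB detB =
  let P , P∈G , M∼E = reduce-order-six M trM detM in
  no-root-of-order-six (conj P∈G B)
    (trans (tr-conj P∈G B) trB) (trans (det-conj P∈G B) detB)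
    (begin
      tr (E · conj P∈G B)              ≡⟨ cong (λ K → tr (K · conj P∈G B)) M∼E ⟨
      tr (conj P∈G M · conj P∈G B)     ≡⟨ cong tr (conj-· P∈G M B) ⟨
      tr (conj P∈G (M · B))            ≡⟨ tr-conj P∈G (M · B) ⟩
      tr (M · B)                       ≡⟨ cong tr MB≡-A ⟩
      tr (-ₘ A)                        ≡⟨ tr-neg A ⟩
      - tr A                           ≡⟨ cong -_ trA ⟩
      -[1+ 2 ]                         ∎)
  where open ≡-Reasoning

-- If the sum had determinant 1, polarisation would give ⟨A, B⟩ = -1, so -A adj B would have trace
-- and determinant 1.
summands-of-trace-3 : ∀ A B → tr A ≡ + 3 → det A ≡ 1ℤ → tr B ≡ + 3 → det B ≡ 1ℤ → det (A +ₘ B) ≢ 1ℤ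
summands-of-trace-3 A B trA detA trB detB det[A+B] =
  order-six-quotient A B (-ₘ (A · adj B)) (-adj-cancel A B detB) trM
    (trans (det-adj A B) (cong₂ _*_ detA detB)) trA trB detB
  where
  lemma : ∀ a b t → a ≡ 1ℤ → b ≡ 1ℤ → a + b + t ≡ 1ℤ → - t ≡ 1ℤ
  lemma a b t a≡1 b≡1 h = -1ℤ ⊛ h ⊕ 1ℤ ⊛ a≡1 ⊕ 1ℤ ⊛ b≡1 ⊢ solve (a ∷ b ∷ t ∷ [])
  trM : tr (-ₘ (A · adj B)) ≡ 1ℤ
  trM = trans (tr-adj A B)
    (lemma (det A) (det B) ⟨ A , B ⟩ detA detB (trans (sym (det-+ A B)) det[A+B]))

no-all-negative : ∀ X Y Z → X · X +ₘ Y · Y ≡ Z · Z →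
  tr X ≡ 1ℤ → det X ≡ -1ℤ → tr Y ≡ 1ℤ → det Y ≡ -1ℤ → det Z ≢ -1ℤ
no-all-negative X Y Z eq trX detX trY detY detZ =
  summands-of-trace-3 (X · X) (Y · Y) (tr²≡3 X trX detX) (det²≡1 X detX) (tr²≡3 Y trY detY) (det²≡1 Y detY)
    (trans (cong det eq) (det²≡1 Z detZ))
  where
  tr²≡3 : ∀ X → tr X ≡ 1ℤ → det X ≡ -1ℤ → tr (X · X) ≡ + 3
  tr²≡3 X trX detX = trans (tr-² X) (cong₂ (λ x δ → x * x - + 2 * δ) trX detX)
  det²≡1 : ∀ X → det X ≡ -1ℤ → det (X · X) ≡ 1ℤ
  det²≡1 X detX = trans (det-· X X) (cong₂ _*_ detX detX)

-- The two inclusions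

Orbits : Triple → Set
Orbits t = (∃ λ T → T ∈ 𝒯 × t ∈ 𝒪 (E , -ₘ R , T)) ⊎ t ∈ 𝒪 (U , V , W) ⊎ t ∈ 𝒪 (V , U , W)

ℳ⊆orbits : ∀ {t} → t ∈ ℳ → Orbits t
ℳ⊆orbits {X , Y , Z} t∈ℳ = orbit (ℳ-invariants t∈ℳ)
  where
  orbit : Solution (det X) (det Y) (det Z) (tr X) (tr Y) (tr Z) → Orbits (X , Y , Z)
  orbit (trX , trY , inj₁ (detX , detY , detZ , trZ)) =
    inj₁ (elliptic-orbit t∈ℳ trX detX trY detY trZ detZ)
  orbit (trX , trY , inj₂ (inj₁ (detX , detY , detZ , trZ))) =
    inj₂ (inj₁ (parabolic-orbit t∈ℳ trX detX trY detY trZ detZ))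
  orbit (trX , trY , inj₂ (inj₂ (inj₁ (detX , detY , detZ , trZ)))) =
    inj₂ (inj₂ (𝒪-swap (parabolic-orbit (ℳ-swap t∈ℳ) trY detY trX detX trZ detZ)))
  orbit (trX , trY , inj₂ (inj₂ (inj₂ (detX , detY , detZ , trZ)))) =
    ⊥-elim (no-all-negative X Y Z (proj₁ (proj₂ t∈ℳ)) trX detX trY detY detZ)

⟦⟧² : ∀ a b c → a * b + b * c + c * a ≡ 1ℤ → ⟦ a , b , c ⟧ · ⟦ a , b , c ⟧ ≡ -ₘ 1ₘ
⟦⟧² a b c h = mat≡ top-left (top-right a c) (bottom-left a b) bottom-right
  where
  top-left : a * a + (- a - c) * (a + b) ≡ -1ℤ
  top-left = -1ℤ ⊛ h ⊢ solve (a ∷ b ∷ c ∷ [])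
  top-right : ∀ a c → a * (- a - c) + (- a - c) * - a ≡ 0ℤ
  top-right = solve-∀
  bottom-left : ∀ a b → (a + b) * a + - a * (a + b) ≡ 0ℤ
  bottom-left = solve-∀
  bottom-right : (a + b) * (- a - c) + - a * - a ≡ -1ℤ
  bottom-right = -1ℤ ⊛ h ⊢ solve (a ∷ b ∷ c ∷ [])

-ₘ-·ˡ : ∀ X Y → -ₘ X · Y ≡ -ₘ (X · Y)
-ₘ-·ˡ (mat a b c d) (mat e f g h) = mat≡ (entry a b e g) (entry a b f h) (entry c d e g) (entry c d f h)
  where
  entry : ∀ a b e g → - a * e + - b * g ≡ - (a * e + b * g)
  entry = solve-∀

-ₘ-·ʳ : ∀ X Y → X · -ₘ Y ≡ -ₘ (X · Y)
-ₘ-·ʳ (mat a b c d) (mat e f g h) = mat≡ (entry a b e g) (entry a b f h) (entry c d e g) (entry c d f h)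
  where
  entry : ∀ a b e g → a * - e + b * - g ≡ - (a * e + b * g)
  entry = solve-∀

E-R-T∈ℳ : ∀ {T} → T ∈ 𝒯 → (E , -ₘ R , T) ∈ ℳ
E-R-T∈ℳ {T} (a , b , c , h , _ , _ , refl) =
  ( (-ₘ R , refl , refl)
  , (E , refl , refl)
  , (-ₘ T , trans (-ₘ-·ˡ T T) (cong -ₘ_ T²≡-1) , trans (-ₘ-·ʳ T T) (cong -ₘ_ T²≡-1))) ,
  -- The left side evaluates to R + R² = -1, because E² = R⁴ = R.
  sym T²≡-1 , 0≤+ 1 , 0≤+ 1 , ≤-reflexive (sym (+-inverseʳ a))
  where
  T²≡-1 : T · T ≡ -ₘ 1ₘ
  T²≡-1 = ⟦⟧² a b c h

U-V-W∈ℳ : (U , V , W) ∈ ℳ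
U-V-W∈ℳ =
  ( (mat -[1+ 1 ] 1ℤ -1ℤ 1ℤ , refl , refl)
  , (mat -1ℤ 1ℤ -[1+ 2 ] (+ 2) , refl , refl)
  , (mat 1ℤ 0ℤ -1ℤ 1ℤ , refl , refl)) ,
  refl , 0≤+ 1 , 0≤+ 1 , 0≤+ 2

orbits⊆ℳ : ∀ {t} → Orbits t → t ∈ ℳ
orbits⊆ℳ (inj₁ (T , T∈𝒯 , t∈𝒪)) = ℳ-conj (E-R-T∈ℳ T∈𝒯) t∈𝒪
orbits⊆ℳ (inj₂ (inj₁ t∈𝒪)) = ℳ-conj U-V-W∈ℳ t∈𝒪
orbits⊆ℳ (inj₂ (inj₂ t∈𝒪)) = ℳ-conj (ℳ-swap U-V-W∈ℳ) t∈𝒪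

-- Disjointness of the orbits

-- The centraliser is ℤ[R], with elements p + rR. Its determinant p² - pr + r² is a positive form,
-- which rules out -1.
E-centraliser : ∀ p q r s → mat p q r s ∈ G → mat p q r s · E ≡ E · mat p q r s →
  q ≡ - r × s ≡ p - r × p * p - p * r + r * r ≡ 1ℤ
E-centraliser p q r s P∈G PE≡EP = q≡ , s≡ , norm (det-sign P∈G)
  where
  e₂₁≡ : r * 1ℤ + s * 1ℤ ≡ 1ℤ * p + 0ℤ * r
  e₂₁≡ = cong e₂₁ PE≡EP
  e₂₂≡ : r * -1ℤ + s * 0ℤ ≡ 1ℤ * q + 0ℤ * s
  e₂₂≡ = cong e₂₂ PE≡EP
  q≡ : q ≡ - r
  q≡ = -1ℤ ⊛ e₂₂≡ ⊢ solve (q ∷ r ∷ s ∷ [])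
  s≡ : s ≡ p - r
  s≡ = 1ℤ ⊛ e₂₁≡ ⊢ solve (p ∷ r ∷ s ∷ [])
  norm : Sign (p * s - q * r) → p * p - p * r + r * r ≡ 1ℤ
  norm (inj₁ det≡1) = 1ℤ ⊛ det≡1 ⊕ - p ⊛ s≡ ⊕ r ⊛ q≡ ⊢ solve (p ∷ q ∷ r ∷ s ∷ [])
  norm (inj₂ det≡-1) = refute 3 (0≤² (+ 2 * p - r) ∔ 0≤+ 3 ∙ 0≤² r)
    (+ 4 ⊛ det≡-1 ⊕ (-[1+ 3 ] * p) ⊛ s≡ ⊕ (+ 4 * r) ⊛ q≡ ⊢ solve (p ∷ q ∷ r ∷ s ∷ []))

-- P = ±1 fixes (a, b, c), while ±R and ±R² rotate it and break one of the order conditions.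
-- Multiplying by σ removes the sign, as σ² = 1.
intertwining-units : ∀ {a b c a′ b′ c′ p q r s} → a ≤ b → a < c → a′ ≤ b′ → a′ < c′ →
  p * a + q * (a + b) ≡ a′ * p + (- a′ - c′) * r →
  p * (- a - c) + q * - a ≡ a′ * q + (- a′ - c′) * s →
  r * a + s * (a + b) ≡ (a′ + b′) * p + - a′ * r →
  q ≡ - r → s ≡ p - r → ∀ σ → Sign σ →
  (p ≡ σ × r ≡ 0ℤ) ⊎ (p ≡ 0ℤ × r ≡ σ) ⊎ (p ≡ σ × r ≡ σ) →
  a ≡ a′ × b ≡ b′ × c ≡ c′
intertwining-units {a} {b} {c} {a′} {b′} {c′} _ _ _ _ e₁₁≡ e₁₂≡ e₂₁≡ refl refl σ sσ (inj₁ (refl , refl)) =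
  a≡a′ , b≡b′ , c≡c′
  where
  a≡a′ : a ≡ a′
  a≡a′ = σ ⊛ e₁₁≡ ⊕ (a′ - a) ⊛ sign² sσ ⊢ solve (σ ∷ a ∷ b ∷ a′ ∷ c′ ∷ [])
  b≡b′ : b ≡ b′
  b≡b′ = σ ⊛ e₂₁≡ ⊕ - σ ⊛ e₁₁≡ ⊕ (b′ - b) ⊛ sign² sσ ⊢ solve (σ ∷ a ∷ b ∷ a′ ∷ b′ ∷ c′ ∷ [])
  c≡c′ : c ≡ c′
  c≡c′ = - σ ⊛ e₁₂≡ ⊕ - σ ⊛ e₁₁≡ ⊕ (c′ - c) ⊛ sign² sσ ⊢ solve (σ ∷ a ∷ b ∷ c ∷ a′ ∷ c′ ∷ [])
intertwining-units {a} {b} {c} {a′} {b′} {c′} a≤b _ _ a′<c′ e₁₁≡ e₁₂≡ e₂₁≡ refl refl σ sσ (inj₂ (inj₁ (refl , refl))) =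
  contradiction (subst₂ _<_ a′≡b c′≡a a′<c′) (≤⇒≯ a≤b)
  where
  a′≡b : a′ ≡ b
  a′≡b = σ ⊛ e₂₁≡ ⊕ (b - a′) ⊛ sign² sσ ⊢ solve (σ ∷ a ∷ b ∷ a′ ∷ b′ ∷ [])
  c′≡a : c′ ≡ a
  c′≡a = - σ ⊛ e₁₂≡ ⊕ (a - c′) ⊛ sign² sσ ⊢ solve (σ ∷ a ∷ c ∷ a′ ∷ c′ ∷ [])
intertwining-units {a} {b} {c} {a′} {b′} {c′} _ a<c a′≤b′ _ e₁₁≡ e₁₂≡ e₂₁≡ refl refl σ sσ (inj₂ (inj₂ (refl , refl))) =
  contradiction (subst₂ _≤_ a′≡c b′≡a a′≤b′) (<⇒≱ a<c)
  where
  a′≡c : a′ ≡ c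
  a′≡c = σ ⊛ e₁₂≡ ⊕ (c - a′) ⊛ sign² sσ ⊢ solve (σ ∷ a ∷ c ∷ a′ ∷ c′ ∷ [])
  b′≡a : b′ ≡ a
  b′≡a = - σ ⊛ e₂₁≡ ⊕ (a - b′) ⊛ sign² sσ ⊢ solve (σ ∷ a ∷ b ∷ a′ ∷ b′ ∷ [])

𝒯-rigid : ∀ {T T′} → T ∈ 𝒯 → T′ ∈ 𝒯 → (E , -ₘ R , T′) ∈ 𝒪 (E , -ₘ R , T) → T ≡ T′
𝒯-rigid (a , b , c , _ , a≤b , a<c , refl) (a′ , b′ , c′ , _ , a′≤b′ , a′<c′ , refl)
  (mat p q r s , P∈G , eq) =
  let q≡ , s≡ , norm≡1 = E-centraliser p q r s P∈G (conj-intertwines P∈G (sym (cong proj₁ eq)))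
      σ , sσ , units = eisenstein-units p r norm≡1
      a≡a′ , b≡b′ , c≡c′ = intertwining-units a≤b a<c a′≤b′ a′<c′
        (cong e₁₁ PT≡T′P) (cong e₁₂ PT≡T′P) (cong e₂₁ PT≡T′P) q≡ s≡ σ sσ units
  in trans (cong ⟦_, b , c ⟧ a≡a′) (cong₂ ⟦ a′ ,_,_⟧ b≡b′ c≡c′)
  where
  PT≡T′P : mat p q r s · ⟦ a , b , c ⟧ ≡ ⟦ a′ , b′ , c′ ⟧ · mat p q r s
  PT≡T′P = conj-intertwines P∈G (sym (cong (λ t → proj₂ (proj₂ t)) eq))

orbit-meet : ∀ {r s t} → t ∈ 𝒪 r → t ∈ 𝒪 s → s ∈ 𝒪 r
orbit-meet t∈𝒪r t∈𝒪s = 𝒪-trans (𝒪-sym t∈𝒪s) t∈𝒪r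

𝒪-tr₃ : ∀ {X Y Z X′ Y′ Z′} → (X′ , Y′ , Z′) ∈ 𝒪 (X , Y , Z) → tr Z′ ≡ tr Z
𝒪-tr₃ {Z = Z} (P , P∈G , refl) = tr-conj P∈G Z

𝒪-det₁ : ∀ {X Y Z X′ Y′ Z′} → (X′ , Y′ , Z′) ∈ 𝒪 (X , Y , Z) → det X′ ≡ det X
𝒪-det₁ {X} (P , P∈G , refl) = det-conj P∈G X

tr-𝒯 : ∀ {T} → T ∈ 𝒯 → tr T ≡ 0ℤ
tr-𝒯 (a , _ , _ , _ , _ , _ , refl) = +-inverseʳ a

theorem1p1 : (ℳ ≐ (λ t → ∃ λ T → T ∈ 𝒯 × t ∈ 𝒪 (-ₘ (R · R) , -ₘ R , T)) ∪ 𝒪 (U , V , W) ∪ 𝒪 (V , U , W)) ×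
    (∀ T T′ → T ∈ 𝒯 → T′ ∈ 𝒯 → T ≢ T′ →
    𝒪 (-ₘ (R · R) , -ₘ R , T) ⊥ 𝒪 (-ₘ (R · R) , -ₘ R , T′)) ×
    (∀ T → T ∈ 𝒯 → 𝒪 (-ₘ (R · R) , -ₘ R , T) ⊥ 𝒪 (U , V , W)) ×
    (∀ T → T ∈ 𝒯 → 𝒪 (-ₘ (R · R) , -ₘ R , T) ⊥ 𝒪 (V , U , W)) ×
    𝒪 (U , V , W) ⊥ 𝒪 (V , U , W)
theorem1p1 =
  (ℳ⊆orbits , orbits⊆ℳ) ,
  (λ T T′ T∈𝒯 T′∈𝒯 T≢T′ (∈𝒪T , ∈𝒪T′) → T≢T′ (𝒯-rigid T∈𝒯 T′∈𝒯 (orbit-meet ∈𝒪T ∈𝒪T′))) ,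
  -- Third entries have trace 0 on `𝒯` but 2 at `W`; for the last pair, the first entries `U` and
  -- `V` have determinants -1 and 1.
  (λ T T∈𝒯 (∈𝒪T , ∈𝒪UVW) → 2≢0 (trans (𝒪-tr₃ (orbit-meet ∈𝒪T ∈𝒪UVW)) (tr-𝒯 T∈𝒯))) ,
  (λ T T∈𝒯 (∈𝒪T , ∈𝒪VUW) → 2≢0 (trans (𝒪-tr₃ (orbit-meet ∈𝒪T ∈𝒪VUW)) (tr-𝒯 T∈𝒯))) ,
  λ (∈𝒪UVW , ∈𝒪VUW) → 1≢-1 (𝒪-det₁ (orbit-meet ∈𝒪UVW ∈𝒪VUW))
  where
  2≢0 : + 2 ≢ 0ℤ
  2≢0 ()
  1≢-1 : 1ℤ ≢ -1ℤ
  1≢-1 ()
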